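{- Let $q$ be an odd prime power, $d\ge2$, and $Q$ a nondegenerate quadratic form on $\mathbb F_q^d$. (a) Let $P\subseteq\mathbb F_q^d$ be nonempty and let $\mathcal S$ be a nonempty family of distinct $Q$-spheres. Then $I(P,\mathcal S)=|P||\mathcal S|$ if and only if, with $L=\operatorname{aff}\Phi(\mathcal S)$ (the affine span), $$P\subseteq B(L),\qquad\mathcal S\subseteq\mathcal S(L).$$ (b) Let $L\subseteq\mathbb F_q^{d+1}$ be an affine subspace with $B(L)\ne\varnothing$, and put $r=\dim L$. Then $r\le d$. Write $L=y_0+U$ with $U$ a linear subspace and $y_0=\Phi(S_Q(c_0,r_0))$. Then there are an $r$-dimensional subspace $W\le\mathbb F_q^d$, a linear functional $\beta:W\to\mathbb F_q$, and $z\in\mathbb F_q^d$ such that $\langle z,w\rangle_Q=-\beta(w)$ for all $w\in W$ and $$\mathcal S(L)=\Bigl\{S_Q\bigl(c_0+\tfrac w2,\ r_0+\beta(w)+\langle c_0,w\rangle_Q+\tfrac14Q(w)\bigr):w\in W\Bigr\},\tag{i}$$ $$B(L)=S_Q(c_0,r_0)\cap\bigl(z+W^{\perp_Q}\bigr).\tag{ii}$$ (c) Conversely, for every choice of $c_0\in\mathbb F_q^d$, $r_0\in\mathbb F_q$, a subspace $W\le\mathbb F_q^d$, a linear functional $\beta:W\to\mathbb F_q$ and $z\in\mathbb F_q^d$ with $\langle z,w\rangle_Q=-\beta(w)$ for all $w\in W$, the sphere system on the right of (i) equals $\mathcal S(L)$ for the affine subspace $L=\Phi(S_Q(c_0,r_0))+\{(w,\beta(w)):w\in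 W\}$, and it has base locus $B(L)$ equal to the right side of (ii); when that base is nonempty, any nonempty subset $P$ of it and any nonempty subset $\mathcal S$ of the sphere system satisfy $I(P,\mathcal S)=|P||\mathcal S|$. (d) The case $r=1$ is precisely a coaxal pencil.
   Context: Put $\langle x,y\rangle_Q=\frac{Q(x+y)-Q(x)-Q(y)}2$ and $W^{\perp_Q}=\{x:\langle x,w\rangle_Q=0\ \forall w\in W\}$. For $c\in\mathbb F_q^d$, $r\in\mathbb F_q$ the $Q$-sphere is $S_Q(c,r)=\{x\in\mathbb F_q^d:Q(x-c)=r\}$; spheres are parametrized by pairs $(c,r)$ and distinct spheres means distinct parameter pairs. $I(P,\mathcal S)=|\{(p,S)\in P\times\mathcal S:p\in S\}|$. The lift is $\Phi(S_Q(c,r))=(2c,r-Q(c))\in\mathbb F_q^{d+1}$. For $x\in\mathbb F_q^d$, $y=(u,a)\in\mathbb F_q^d\times\mathbb F_q$ put $\Lambda_x(y)=Q(x)-\langle x,u\rangle_Q-a$. For a (nonempty) affine subspace $L\subseteq\mathbb F_q^{d+1}$ put $\mathcal S(L)=\Phi^{ -1}(L)$ and $B(L)=\{x\in\mathbb F_q^d:\Lambda_x(y)=0\ \forall y\in L\}$. A coaxal pencil is the family of $q$ spheres whose lifts are the points $(1-t)\Phi(S_0)+t\Phi(S_1)$, $t\in\mathbb F_q$, for two distinct spheres $S_0,S_1$. -}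

module Defs where

open import Algebra.Bundles using (CommutativeRing)
open import Algebra.Core using (Op₁; Op₂)
open import Algebra.Structures using (IsCommutativeRing)
open import Data.Fin.Base using (Fin)
import Data.Fin.Properties as Fin
open import Data.List.Base using (List; length; filter; cartesianProduct)
open import Data.Nat.Base as ℕ using (ℕ; suc; _^_)
open import Data.Nat.Primality using (Prime)
open import Data.Product.Base using (Σ; ∃; ∃-syntax; _×_; _,_; uncurry)
open import Data.Vec.Base using (Vec; zipWith; map; replicate; foldr′; init; last; _∷ʳ_)
open import Data.Vec.Relation.Unary.All using (All)
open import Function.Bundles using (_↔_)
open import Function.Properties.Inverse using (Inverse⇒Injection)
open import Level using (0ℓ)
open import Relation.Binary.Definitions using (DecidableEquality)
open import Relation.Binary.PropositionalEquality.Core using (_≡_; _≢_)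
open import Relation.Nullary.Decidable.Core using (Dec)
open import Relation.Nullary.Decidable using (via-injection)
open import Relation.Unary using (Pred; _∈_; _≐_)

IsPrimePower : ℕ → Set
IsPrimePower q = ∃[ p ] ∃[ k ] Prime p × 1 ℕ.≤ k × q ≡ p ^ k

record FiniteField (q : ℕ) : Set₁ where
  infix  9 _⁻¹
  infix  8 -_
  infixl 7 _*_ _/_
  infixl 6 _+_ _-_
  field
    Carrier           : Set
    _+_ _*_           : Op₂ Carrier
    -_                : Op₁ Carrier
    0# 1#             : Carrier
    isCommutativeRing : IsCommutativeRing _≡_ _+_ _*_ -_ 0# 1#
    0≢1               : 0# ≢ 1#
    -- Total; the value at 0# is unconstrained.
    _⁻¹               : Op₁ Carrier
    ⁻¹-inverseʳ       : ∀ x → x ≢ 0# → x * x ⁻¹ ≡ 1#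
    enumeration       : Carrier ↔ Fin q

  commutativeRing : CommutativeRing 0ℓ 0ℓ
  commutativeRing = record { isCommutativeRing = isCommutativeRing }

  _-_ _/_ : Op₂ Carrier
  x - y = x + (- y)
  x / y = x * y ⁻¹

  2# 4# : Carrier
  2# = 1# + 1#
  4# = 2# * 2#

  _≟_ : DecidableEquality Carrier
  _≟_ = via-injection (Inverse⇒Injection enumeration) Fin._≟_

module LinearAlgebra {q : ℕ} (F : FiniteField q) where
  open FiniteField F

  infixr 7 _•_
  infixl 6 _+ᵛ_ _-ᵛ_
  infixl 6 _⊕_

  𝔽^ : ℕ → Set
  𝔽^ n = Vec Carrier n

  _+ᵛ_ _-ᵛ_ : ∀ {n} → Op₂ (𝔽^ n)
  _+ᵛ_ = zipWith _+_
  _-ᵛ_ = zipWith _-_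

  _•_ : ∀ {n} → Carrier → 𝔽^ n → 𝔽^ n
  a • x = map (a *_) x

  0ᵛ : ∀ {n} → 𝔽^ n
  0ᵛ = replicate _ 0#

  sum : ∀ {k} → Vec Carrier k → Carrier
  sum = foldr′ _+_ 0#

  combination : ∀ {n k} → Vec Carrier k → Vec (𝔽^ n) k → 𝔽^ n
  combination ts xs = foldr′ _+ᵛ_ 0ᵛ (zipWith _•_ ts xs)

  record IsSubspace {n} (U : Pred (𝔽^ n) 0ℓ) : Set where
    field
      0-closed : 0ᵛ ∈ U
      +-closed : ∀ {u v} → u ∈ U → v ∈ U → u +ᵛ v ∈ U
      •-closed : ∀ a {u} → u ∈ U → a • u ∈ U

  Span : ∀ {n k} → Vec (𝔽^ n) k → Pred (𝔽^ n) 0ℓ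
  Span xs v = ∃[ ts ] v ≡ combination ts xs

  LinearlyIndependent : ∀ {n k} → Vec (𝔽^ n) k → Set
  LinearlyIndependent xs = ∀ ts → combination ts xs ≡ 0ᵛ → ts ≡ 0ᵛ

  HasDim : ∀ {n} → Pred (𝔽^ n) 0ℓ → ℕ → Set
  HasDim {n} U r = Σ (Vec (𝔽^ n) r) λ b → LinearlyIndependent b × U ≐ Span b

  _⊕_ : ∀ {n} → 𝔽^ n → Pred (𝔽^ n) 0ℓ → Pred (𝔽^ n) 0ℓ
  (y₀ ⊕ U) y = ∃[ u ] u ∈ U × y ≡ y₀ +ᵛ u

  IsAffineSubspace : ∀ {n} → Pred (𝔽^ n) 0ℓ → Set₁
  IsAffineSubspace L = ∃[ y₀ ] ∃[ U ] IsSubspace U × L ≐ y₀ ⊕ U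

  HasAffineDim : ∀ {n} → Pred (𝔽^ n) 0ℓ → ℕ → Set₁
  HasAffineDim L r = ∃[ y₀ ] ∃[ U ] IsSubspace U × L ≐ y₀ ⊕ U × HasDim U r

  -- Coefficients summing to 1# exclude the empty combination, because 0# ≢ 1#.
  aff : ∀ {n} → Pred (𝔽^ n) 0ℓ → Pred (𝔽^ n) 0ℓ
  aff {n} X y = ∃[ k ] Σ (Vec (𝔽^ n) k) λ xs → Σ (Vec Carrier k) λ ts →
                All X xs × sum ts ≡ 1# × y ≡ combination ts xs

  record LinearFunctional {n} (W : Pred (𝔽^ n) 0ℓ) : Set where
    field
      to : ∀ w → w ∈ W → Carrier
      -- The value depends on the vector only, not on the membership proof.
      irrelevant : ∀ {w} (p p′ : w ∈ W) → to w p ≡ to w p′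
      +-homo : ∀ {v w} (p : v ∈ W) (p′ : w ∈ W) (s : v +ᵛ w ∈ W) →
               to (v +ᵛ w) s ≡ to v p + to w p′
      •-homo : ∀ a {w} (p : w ∈ W) (s : a • w ∈ W) →
               to (a • w) s ≡ a * to w p

  graph : ∀ {n} (W : Pred (𝔽^ n) 0ℓ) → LinearFunctional W → Pred (𝔽^ (suc n)) 0ℓ
  graph W β y = ∃[ w ] Σ (w ∈ W) λ w∈W → y ≡ w ∷ʳ LinearFunctional.to β w w∈W

  record QuadraticForm (d : ℕ) : Set where
    field
      form : 𝔽^ d → Carrier

    polar : 𝔽^ d → 𝔽^ d → Carrier
    polar x y = form (x +ᵛ y) - form x - form y

    field
      homogeneous : ∀ a x → form (a • x) ≡ a * a * form x
      -- polar is symmetric, so linearity on the left makes it bilinear.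
      polar-+ˡ    : ∀ x y z → polar (x +ᵛ y) z ≡ polar x z + polar y z
      polar-•ˡ    : ∀ a x y → polar (a • x) y ≡ a * polar x y

module SphereGeometry {q : ℕ} (F : FiniteField q) {d : ℕ}
                      (Q : LinearAlgebra.QuadraticForm F d) where
  open FiniteField F
  open LinearAlgebra F
  open QuadraticForm Q using (form; polar)

  ⟨_,_⟩ : 𝔽^ d → 𝔽^ d → Carrier
  ⟨ x , y ⟩ = polar x y / 2#

  NonDegenerate : Set
  NonDegenerate = ∀ x → (∀ y → ⟨ x , y ⟩ ≡ 0#) → x ≡ 0ᵛ

  infix 10 _⊥

  _⊥ : Pred (𝔽^ d) 0ℓ → Pred (𝔽^ d) 0ℓ
  (W ⊥) x = ∀ w → w ∈ W → ⟨ x , w ⟩ ≡ 0#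

  -- A sphere is its parameter pair (centre , radius), so spheres with the
  -- same points but different parameters are distinct.
  Sphere : Set
  Sphere = 𝔽^ d × Carrier

  points : Sphere → Pred (𝔽^ d) 0ℓ
  points (c , r) x = form (x -ᵛ c) ≡ r

  incident? : (x : 𝔽^ d) (S : Sphere) → Dec (x ∈ points S)
  incident? x (c , r) = form (x -ᵛ c) ≟ r

  -- Finite sets of points and of spheres are duplicate-free lists.
  incidences : List (𝔽^ d) → List Sphere → ℕ
  incidences P 𝒯 = length (filter (uncurry incident?) (cartesianProduct P 𝒯))

  -- 𝔽^d × 𝔽 is identified with 𝔽^(d+1) by appending the last coordinate.
  Φ : Sphere → 𝔽^ (suc d)
  Φ (c , r) = (2# • c) ∷ʳ (r - form c)

  Λ : 𝔽^ d → 𝔽^ (suc d) → Carrier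
  Λ x y = form x - ⟨ x , init y ⟩ - last y

  𝒮 : Pred (𝔽^ (suc d)) 0ℓ → Pred Sphere 0ℓ
  𝒮 L S = Φ S ∈ L

  B : Pred (𝔽^ (suc d)) 0ℓ → Pred (𝔽^ d) 0ℓ
  B L x = ∀ y → y ∈ L → Λ x y ≡ 0#

  commonPoints : Pred Sphere 0ℓ → Pred (𝔽^ d) 0ℓ
  commonPoints 𝒯 x = ∀ S → S ∈ 𝒯 → x ∈ points S

  sphereSystem : 𝔽^ d → Carrier → (W : Pred (𝔽^ d) 0ℓ) → LinearFunctional W →
                 Pred Sphere 0ℓ
  sphereSystem c₀ r₀ W β S = ∃[ w ] Σ (w ∈ W) λ w∈W →
    S ≡ ( c₀ +ᵛ 2# ⁻¹ • w
        , r₀ + LinearFunctional.to β w w∈W + ⟨ c₀ , w ⟩ + form w / 4# )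

  IsCoaxalPencil : Pred Sphere 0ℓ → Set
  IsCoaxalPencil 𝒯 = ∃[ S₀ ] ∃[ S₁ ] S₀ ≢ S₁ ×
    𝒯 ≐ λ S → ∃[ t ] Φ S ≡ (1# - t) • Φ S₀ +ᵛ t • Φ S₁

{-# OPTIONS --safe #-}
-- Λ x (Φ (c , r)) = form (x -ᵛ c) - r, so incidence is the vanishing of Λ; since Λ x y = form x - ℓ x y
-- with ℓ x linear, vanishing passes from a set of lifts to its affine span.
-- If x ∈ B (y₀ ⊕ U), then ℓ x vanishes on U, so every u ∈ U satisfies last u = - ⟨ x , init u ⟩: U is the
-- graph of β = - ⟨ x , _ ⟩ on its projection W, and z = x. The dimension bound comes from q ^ r ≤ q ^ d.
-- Halving is possible because the q-fold sum of 1# vanishes, which for odd q contradicts 2# = 0#.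
module Submission where

open import Defs
open import Algebra.Bundles using (CommutativeRing)
open import Algebra.Bundles.Raw using (RawRing)
open import Data.Fin.Base using (Fin; zero)
open import Data.Fin.Permutation using (Permutation; permutation)
import Data.Fin.Properties as Fin
open import Data.List.Base using (List; []; _∷_; length; filter; cartesianProduct; map)
open import Data.List.Membership.Propositional using () renaming (_∈_ to _∈ₗ_)
open import Data.List.Membership.Propositional.Properties
  using (∈-map⁺; ∈-map⁻; ∈-cartesianProduct⁺; ∈-cartesianProduct⁻)
open import Data.List.Properties using (length-++; length-map; filter-all; filter-complete)
import Data.List.Relation.Unary.All as ListAll
open import Data.List.Relation.Unary.All.Properties using (all-filter)
open import Data.List.Relation.Unary.Unique.Propositional using (Unique)
open import Data.Maybe.Base as Maybe using (Maybe)
open import Data.Nat.Base as ℕ using (ℕ; zero; suc; _≤_; _^_)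
open import Data.Nat.Divisibility using (_∣_; _∣0; ∣-refl; ∣m∣n⇒∣m+n)
open import Data.Nat.Primality using (prime⇒nonTrivial)
import Data.Nat.Properties as ℕ
open import Data.Product.Base using (Σ; ∃-syntax; _×_; _,_; proj₁; proj₂; uncurry)
open import Data.Product.Function.NonDependent.Propositional using (_×-↔_)
open import Data.Vec.Base as Vec using (Vec; []; _∷_; head; uncons; init; last; _∷ʳ_)
open import Data.Vec.Properties
  using (zipWith-comm; zipWith-identityʳ; map-cong; map-id; map-∷ʳ; init-∷ʳ; last-∷ʳ; ∷ʳ-injective)
open import Data.Vec.Relation.Unary.All as All using (All; []; _∷_)
open import Function.Base using (case_of_)
open import Function.Bundles using (_↔_; _⇔_; Inverse; Injection; Equivalence; mk↔ₛ′; mk↣; mk⇔)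
open import Function.Definitions using (Injective)
open import Function.Properties.Injection using (↣-trans)
open import Function.Properties.Inverse using (Inverse⇒Injection; ↔-sym; ↔-trans)
open import Level using (0ℓ)
open import Relation.Binary.PropositionalEquality
  using (_≡_; _≢_; refl; sym; trans; cong; cong₂; subst; module ≡-Reasoning)
open import Relation.Nullary.Decidable.Core using (Dec; yes; no; dec⇒maybe)
open import Relation.Nullary.Negation.Core using (¬_; contradiction)
open import Relation.Unary using (Pred; _∈_; _⊆_; _≐_; _∩_; Satisfiable)

-- A nonempty base is what keeps `U` away from the vertical axis. A vector of `U` with zero `init`
-- and last coordinate `a` would translate lifts without moving centres, giving concentric spheres
-- of different radii, which share no point unless `a` is `0#`; in the algebra, `ℓ x` takes the
-- value `a` there and has to vanish. Hence `init` is injective on `U`, and the dimension can be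
-- counted in `𝔽^ d`, one coordinate below the space of lifts. A subspace is an arbitrary predicate,
-- so no basis can be computed from it. Every basis is transported from the one that accompanies a
-- dimension, and as that basis may belong to another presentation of the same affine subspace,
-- uniqueness of the direction has to be proved. The parameters in `sphereSystem` are those of the
-- sphere whose lift is `Φ (c₀ , r₀)` translated by a vector of the graph: halving comes from the
-- factor `2#` in `Φ`, and the terms in `c₀` and `w` beside `β` are the growth of `form` at the
-- centre.

-- Counting vectors and related pairs.

Vec↔Fin : ∀ {A : Set} {q} → A ↔ Fin q → ∀ n → Vec A n ↔ Fin (q ^ n)
Vec↔Fin e zero    = mk↔ₛ′ (λ _ → zero) (λ _ → []) (λ { zero → refl }) (λ { [] → refl })
Vec↔Fin e (suc n) =
  ↔-trans (mk↔ₛ′ uncons (uncurry _∷_) (λ _ → refl) (λ { (_ ∷ _) → refl }))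
  (↔-trans (e ×-↔ Vec↔Fin e n) (↔-sym Fin.*↔×))

length-cartesianProduct : ∀ {A B : Set} (xs : List A) (ys : List B) →
                          length (cartesianProduct xs ys) ≡ length xs ℕ.* length ys
length-cartesianProduct []       ys = refl
length-cartesianProduct (x ∷ xs) ys = trans
  (length-++ (map (x ,_) ys))
  (cong₂ ℕ._+_ (length-map (x ,_) ys) (length-cartesianProduct xs ys))

-- A filtered list as long as the original has dropped nothing, so equality of the two counts forces
-- every pair of the product to pass the test.
length-filter-cartesianProduct :
  ∀ {A B : Set} {R : A → B → Set} (R? : ∀ x y → Dec (R x y)) xs ys →
  (length (filter (uncurry R?) (cartesianProduct xs ys)) ≡ length xs ℕ.* length ys) ⇔
  (∀ {x y} → x ∈ₗ xs → y ∈ₗ ys → R x y)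
length-filter-cartesianProduct {R = R} R? xs ys = mk⇔ related full
  where
  related : length (filter (uncurry R?) (cartesianProduct xs ys)) ≡ length xs ℕ.* length ys →
            ∀ {x y} → x ∈ₗ xs → y ∈ₗ ys → R x y
  related eq x∈xs y∈ys = ListAll.lookup
    (subst (ListAll.All (uncurry R))
      (filter-complete (uncurry R?) (trans eq (sym (length-cartesianProduct xs ys))))
      (all-filter (uncurry R?) (cartesianProduct xs ys)))
    (∈-cartesianProduct⁺ x∈xs y∈ys)

  full : (∀ {x y} → x ∈ₗ xs → y ∈ₗ ys → R x y) →
         length (filter (uncurry R?) (cartesianProduct xs ys)) ≡ length xs ℕ.* length ys
  full rel = trans
    (cong length (filter-all (uncurry R?) (ListAll.tabulate λ xy∈ →
      uncurry rel (∈-cartesianProduct⁻ xs ys xy∈))))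
    (length-cartesianProduct xs ys)

-- A ring solver with integer coefficients.

module IntegerRingSolver {q : ℕ} (F : FiniteField q) where
  open FiniteField F
  open CommutativeRing commutativeRing
    using (ring; semiring; +-identityʳ; +-comm; +-commutativeSemigroup)
  open import Algebra.Properties.Ring ring
    using (-0#≈0#; -‿+-comm; ⁻¹-anti-homo-//; x∙y⁻¹≈ε⇒x≈y; x≈y⇒x∙y⁻¹≈ε; x[y-z]≈xy-xz; [y-z]x≈yx-zx)
  open import Algebra.Properties.CommutativeSemigroup +-commutativeSemigroup using (interchange)
  open import Algebra.Properties.Semiring.Mult.TCOptimised semiring
    renaming (_×_ to _⋆_; ×-homo-+ to ⋆-homo-+; ×1-homo-* to ⋆1-homo-*)
  open import Algebra.Solver.Ring.AlmostCommutativeRing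
  open ≡-Reasoning

  -- (m , n) stands for the integer m − n.
  differences : RawRing 0ℓ 0ℓ
  differences = record
    { Carrier = ℕ × ℕ
    ; _≈_     = _≡_
    ; _+_     = λ (m , n) (m′ , n′) → m ℕ.+ m′ , n ℕ.+ n′
    ; _*_     = λ (m , n) (m′ , n′) → m ℕ.* m′ ℕ.+ n ℕ.* n′ , m ℕ.* n′ ℕ.+ n ℕ.* m′
    ; -_      = λ (m , n) → n , m
    ; 0#      = 0 , 0
    ; 1#      = 1 , 0
    }

  -- The first clause makes ⟦ 1 , 0 ⟧ and ⟦ 2 , 0 ⟧ reduce to 1# and 2#.
  ⟦_⟧ : ℕ × ℕ → Carrier
  ⟦ m , zero ⟧      = m ⋆ 1#
  ⟦ m , n@(suc _) ⟧ = m ⋆ 1# - n ⋆ 1#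

  -- The case split in `⟦_⟧` serves computation only; the homomorphism proofs work with this uniform
  -- formula.
  ⟦⟧-difference : ∀ m n → ⟦ m , n ⟧ ≡ m ⋆ 1# - n ⋆ 1#
  ⟦⟧-difference m zero    = sym (trans (cong (m ⋆ 1# +_) -0#≈0#) (+-identityʳ _))
  ⟦⟧-difference m (suc n) = refl

  +-difference : ∀ a b c d → (a + c) - (b + d) ≡ (a - b) + (c - d)
  +-difference a b c d = trans (cong (a + c +_) (sym (-‿+-comm b d))) (interchange a c (- b) (- d))

  *-difference : ∀ a b c d → (a * c + b * d) - (a * d + b * c) ≡ (a - b) * (c - d)
  *-difference a b c d = begin
    (a * c + b * d) - (a * d + b * c)  ≡⟨ +-difference (a * c) (a * d) (b * d) (b * c) ⟩
    (a * c - a * d) + (b * d - b * c)  ≡⟨ cong₂ _+_ (sym (x[y-z]≈xy-xz a c d)) (sym (⁻¹-anti-homo-// (b * c) (b * d))) ⟩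
    a * (c - d) - (b * c - b * d)      ≡⟨ cong (λ e → a * (c - d) - e) (sym (x[y-z]≈xy-xz b c d)) ⟩
    a * (c - d) - b * (c - d)          ≡⟨ sym ([y-z]x≈yx-zx (c - d) a b) ⟩
    (a - b) * (c - d)                  ∎

  evaluation : differences -Raw-AlmostCommutative⟶ fromCommutativeRing commutativeRing
  evaluation = record
    { ⟦_⟧    = ⟦_⟧
    ; +-homo = λ (m , n) (m′ , n′) → begin
        ⟦ m ℕ.+ m′ , n ℕ.+ n′ ⟧
          ≡⟨ ⟦⟧-difference (m ℕ.+ m′) (n ℕ.+ n′) ⟩
        (m ℕ.+ m′) ⋆ 1# - (n ℕ.+ n′) ⋆ 1#
          ≡⟨ cong₂ _-_ (⋆-homo-+ 1# m m′) (⋆-homo-+ 1# n n′) ⟩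
        (m ⋆ 1# + m′ ⋆ 1#) - (n ⋆ 1# + n′ ⋆ 1#)
          ≡⟨ +-difference (m ⋆ 1#) (n ⋆ 1#) (m′ ⋆ 1#) (n′ ⋆ 1#) ⟩
        (m ⋆ 1# - n ⋆ 1#) + (m′ ⋆ 1# - n′ ⋆ 1#)
          ≡⟨ sym (cong₂ _+_ (⟦⟧-difference m n) (⟦⟧-difference m′ n′)) ⟩
        ⟦ m , n ⟧ + ⟦ m′ , n′ ⟧ ∎
    ; *-homo = λ (m , n) (m′ , n′) → begin
        ⟦ m ℕ.* m′ ℕ.+ n ℕ.* n′ , m ℕ.* n′ ℕ.+ n ℕ.* m′ ⟧
          ≡⟨ ⟦⟧-difference (m ℕ.* m′ ℕ.+ n ℕ.* n′) (m ℕ.* n′ ℕ.+ n ℕ.* m′) ⟩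
        (m ℕ.* m′ ℕ.+ n ℕ.* n′) ⋆ 1# - (m ℕ.* n′ ℕ.+ n ℕ.* m′) ⋆ 1#
          ≡⟨ cong₂ _-_ (⋆-homo-products m m′ n n′) (⋆-homo-products m n′ n m′) ⟩
        (m ⋆ 1# * (m′ ⋆ 1#) + n ⋆ 1# * (n′ ⋆ 1#)) - (m ⋆ 1# * (n′ ⋆ 1#) + n ⋆ 1# * (m′ ⋆ 1#))
          ≡⟨ *-difference (m ⋆ 1#) (n ⋆ 1#) (m′ ⋆ 1#) (n′ ⋆ 1#) ⟩
        (m ⋆ 1# - n ⋆ 1#) * (m′ ⋆ 1# - n′ ⋆ 1#)
          ≡⟨ sym (cong₂ _*_ (⟦⟧-difference m n) (⟦⟧-difference m′ n′)) ⟩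
        ⟦ m , n ⟧ * ⟦ m′ , n′ ⟧ ∎
    ; -‿homo = λ (m , n) → begin
        ⟦ n , m ⟧              ≡⟨ ⟦⟧-difference n m ⟩
        n ⋆ 1# - m ⋆ 1#        ≡⟨ sym (⁻¹-anti-homo-// (m ⋆ 1#) (n ⋆ 1#)) ⟩
        - (m ⋆ 1# - n ⋆ 1#)    ≡⟨ cong -_ (sym (⟦⟧-difference m n)) ⟩
        - ⟦ m , n ⟧            ∎
    ; 0-homo = refl
    ; 1-homo = refl
    }
    where
    ⋆-homo-products : ∀ a b c d → (a ℕ.* b ℕ.+ c ℕ.* d) ⋆ 1# ≡ a ⋆ 1# * (b ⋆ 1#) + c ⋆ 1# * (d ⋆ 1#)
    ⋆-homo-products a b c d =
      trans (⋆-homo-+ 1# (a ℕ.* b) (c ℕ.* d)) (cong₂ _+_ (⋆1-homo-* a b) (⋆1-homo-* c d))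

  -- Two differences denote the same integer when their cross sums agree. Integers that coincide
  -- only modulo the characteristic are left undecided, which `Maybe` permits.
  ⟦⟧-≡? : (x y : ℕ × ℕ) → Maybe (⟦ x ⟧ ≡ ⟦ y ⟧)
  ⟦⟧-≡? (m , n) (m′ , n′) = Maybe.map equal (dec⇒maybe (m ℕ.+ n′ ℕ.≟ m′ ℕ.+ n))
    where
    equal : m ℕ.+ n′ ≡ m′ ℕ.+ n → ⟦ m , n ⟧ ≡ ⟦ m′ , n′ ⟧
    equal eq = x∙y⁻¹≈ε⇒x≈y _ _ (begin
      ⟦ m , n ⟧ - ⟦ m′ , n′ ⟧                       ≡⟨ cong₂ _-_ (⟦⟧-difference m n) (⟦⟧-difference m′ n′) ⟩
      (m ⋆ 1# - n ⋆ 1#) - (m′ ⋆ 1# - n′ ⋆ 1#)       ≡⟨ cong (m ⋆ 1# - n ⋆ 1# +_) (⁻¹-anti-homo-// (m′ ⋆ 1#) (n′ ⋆ 1#)) ⟩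
      (m ⋆ 1# - n ⋆ 1#) + (n′ ⋆ 1# - m′ ⋆ 1#)       ≡⟨ sym (+-difference (m ⋆ 1#) (n ⋆ 1#) (n′ ⋆ 1#) (m′ ⋆ 1#)) ⟩
      (m ⋆ 1# + n′ ⋆ 1#) - (n ⋆ 1# + m′ ⋆ 1#)       ≡⟨ x≈y⇒x∙y⁻¹≈ε (begin
        m ⋆ 1# + n′ ⋆ 1#   ≡⟨ sym (⋆-homo-+ 1# m n′) ⟩
        (m ℕ.+ n′) ⋆ 1#    ≡⟨ cong (_⋆ 1#) eq ⟩
        (m′ ℕ.+ n) ⋆ 1#    ≡⟨ ⋆-homo-+ 1# m′ n ⟩
        m′ ⋆ 1# + n ⋆ 1#   ≡⟨ +-comm (m′ ⋆ 1#) (n ⋆ 1#) ⟩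
        n ⋆ 1# + m′ ⋆ 1#   ∎) ⟩
      0#                                            ∎)

  open import Algebra.Solver.Ring differences (fromCommutativeRing commutativeRing) evaluation ⟦⟧-≡? public
    using (solve; con; _:=_; _:+_; _:*_; _:-_; :-_)


-- Odd characteristic and inverses.

module FieldProperties {q : ℕ} (F : FiniteField q) where
  open FiniteField F
  open CommutativeRing commutativeRing
    using (ring; semiring; +-commutativeMonoid; zeroˡ; *-identityˡ; *-identityʳ)
  open import Algebra.Properties.Ring ring using (+-identityʳ-unique)
  open import Algebra.Properties.CommutativeMonoid.Sum +-commutativeMonoid
    using (sum; sum-cong-≗; sum-permute; ∑-distrib-+; sum-replicate)
  open import Algebra.Properties.Semiring.Mult semiring using () renaming (_×_ to _⋆_)
  open Inverse enumeration using (to; from; strictlyInverseˡ; strictlyInverseʳ)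
  open IntegerRingSolver F
  open ≡-Reasoning

  -- Adding `1#` is conjugated by `enumeration`, because `sum-permute` reindexes sums over `Fin q`.
  translation : Permutation q q
  translation = permutation
    (λ i → to (from i + 1#))
    (λ i → to (from i - 1#))
    (λ i → begin
      to (from (to (from i - 1#)) + 1#)  ≡⟨ cong (λ x → to (x + 1#)) (strictlyInverseʳ (from i - 1#)) ⟩
      to (from i - 1# + 1#)              ≡⟨ cong to (solve 2 (λ x y → x :- y :+ y := x) refl (from i) 1#) ⟩
      to (from i)                        ≡⟨ strictlyInverseˡ i ⟩
      i                                  ∎)
    (λ i → begin
      to (from (to (from i + 1#)) - 1#)  ≡⟨ cong (λ x → to (x - 1#)) (strictlyInverseʳ (from i + 1#)) ⟩
      to (from i + 1# - 1#)              ≡⟨ cong to (solve 2 (λ x y → x :+ y :- y := x) refl (from i) 1#) ⟩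
      to (from i)                        ≡⟨ strictlyInverseˡ i ⟩
      i                                  ∎)

  -- Translation by 1# permutes the field, so adding q ⋆ 1# to the sum of all elements does not change it.
  q⋆1≡0 : q ⋆ 1# ≡ 0#
  q⋆1≡0 = +-identityʳ-unique (sum from) (q ⋆ 1#) (sym (begin
    sum from                              ≡⟨ sum-permute from translation ⟩
    sum (λ i → from (to (from i + 1#)))   ≡⟨ sum-cong-≗ (λ i → strictlyInverseʳ (from i + 1#)) ⟩
    sum (λ i → from i + 1#)               ≡⟨ ∑-distrib-+ from (λ _ → 1#) ⟩
    sum from + sum {q} (λ _ → 1#)         ≡⟨ cong (sum from +_) (sum-replicate q) ⟩
    sum from + q ⋆ 1#                     ∎))

  -- Descending by two removes a summand `2#`, which is zero by assumption, and preserves oddness;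
  -- the descent can only end at one.
  odd⋆1≡1 : 2# ≡ 0# → ∀ n → ¬ (2 ∣ n) → n ⋆ 1# ≡ 1#
  odd⋆1≡1 2≡0 0             odd = contradiction (2 ∣0) odd
  odd⋆1≡1 2≡0 1             odd = solve 1 (λ x → x :+ con (0 , 0) := x) refl 1#
  odd⋆1≡1 2≡0 (suc (suc n)) odd = begin
    1# + (1# + n ⋆ 1#)  ≡⟨ solve 2 (λ x y → x :+ (x :+ y) := (x :+ x) :+ y) refl 1# (n ⋆ 1#) ⟩
    2# + n ⋆ 1#         ≡⟨ cong₂ _+_ 2≡0 (odd⋆1≡1 2≡0 n (λ 2∣n → odd (∣m∣n⇒∣m+n ∣-refl 2∣n))) ⟩
    0# + 1#             ≡⟨ solve 1 (λ x → con (0 , 0) :+ x := x) refl 1# ⟩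
    1#                  ∎

  2≢0 : ¬ (2 ∣ q) → 2# ≢ 0#
  2≢0 odd 2≡0 = 0≢1 (trans (sym q⋆1≡0) (odd⋆1≡1 2≡0 q odd))

  -- Serves to evaluate the inverse of `4#`. Since `_⁻¹` is constrained only away from `0#`, the
  -- proof has to extract `x ≢ 0#` from the product being `1#`.
  ⁻¹-unique : ∀ x y → x * y ≡ 1# → x ⁻¹ ≡ y
  ⁻¹-unique x y xy≡1 = begin
    x ⁻¹               ≡⟨ sym (*-identityʳ (x ⁻¹)) ⟩
    x ⁻¹ * 1#          ≡⟨ cong (x ⁻¹ *_) (sym xy≡1) ⟩
    x ⁻¹ * (x * y)     ≡⟨ solve 3 (λ x y z → z :* (x :* y) := (x :* z) :* y) refl x y (x ⁻¹) ⟩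
    (x * x ⁻¹) * y     ≡⟨ cong (_* y) (⁻¹-inverseʳ x x≢0) ⟩
    1# * y             ≡⟨ *-identityˡ y ⟩
    y                  ∎
    where
    x≢0 : x ≢ 0#
    x≢0 x≡0 = 0≢1 (trans (sym (zeroˡ y)) (trans (cong (_* y) (sym x≡0)) xy≡1))

-- Vectors, subspaces and dimension.

module VectorProperties {q : ℕ} (F : FiniteField q) where
  open FiniteField F
  open LinearAlgebra F
  open CommutativeRing commutativeRing
    using (+-identityʳ; +-comm; zeroˡ; zeroʳ; *-identityˡ; *-assoc; *-comm; distribˡ; distribʳ)
  open IntegerRingSolver F
  open ≡-Reasoning

  private variable
    m n k : ℕ

  +ᵛ-comm : (x y : 𝔽^ n) → x +ᵛ y ≡ y +ᵛ x
  +ᵛ-comm = zipWith-comm +-comm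

  +ᵛ-identityʳ : (x : 𝔽^ n) → x +ᵛ 0ᵛ ≡ x
  +ᵛ-identityʳ = zipWith-identityʳ +-identityʳ

  +ᵛ-interchange : (w x y z : 𝔽^ n) → (w +ᵛ x) +ᵛ (y +ᵛ z) ≡ (w +ᵛ y) +ᵛ (x +ᵛ z)
  +ᵛ-interchange []      []      []      []      = refl
  +ᵛ-interchange (a ∷ w) (b ∷ x) (c ∷ y) (d ∷ z) = cong₂ _∷_
    (solve 4 (λ a b c d → (a :+ b) :+ (c :+ d) := (a :+ c) :+ (b :+ d)) refl a b c d)
    (+ᵛ-interchange w x y z)

  •-assoc : ∀ a b (x : 𝔽^ n) → (a * b) • x ≡ a • (b • x)
  •-assoc a b []      = refl
  •-assoc a b (c ∷ x) = cong₂ _∷_ (*-assoc a b c) (•-assoc a b x)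

  •-identity : (x : 𝔽^ n) → 1# • x ≡ x
  •-identity x = trans (map-cong *-identityˡ x) (map-id x)

  •-distribˡ : ∀ a (x y : 𝔽^ n) → a • (x +ᵛ y) ≡ a • x +ᵛ a • y
  •-distribˡ a []      []      = refl
  •-distribˡ a (b ∷ x) (c ∷ y) = cong₂ _∷_ (distribˡ a b c) (•-distribˡ a x y)

  •-distribʳ : ∀ a b (x : 𝔽^ n) → (a + b) • x ≡ a • x +ᵛ b • x
  •-distribʳ a b []      = refl
  •-distribʳ a b (c ∷ x) = cong₂ _∷_ (distribʳ c a b) (•-distribʳ a b x)

  •-zeroˡ : (x : 𝔽^ n) → 0# • x ≡ 0ᵛ
  •-zeroˡ []      = refl
  •-zeroˡ (a ∷ x) = cong₂ _∷_ (zeroˡ a) (•-zeroˡ x)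

  •-zeroʳ : ∀ {n} a → a • 0ᵛ {n} ≡ 0ᵛ
  •-zeroʳ {zero}  a = refl
  •-zeroʳ {suc n} a = cong₂ _∷_ (zeroʳ a) (•-zeroʳ a)

  -ᵛ-as-+ᵛ : (x y : 𝔽^ n) → x -ᵛ y ≡ x +ᵛ (- 1#) • y
  -ᵛ-as-+ᵛ []      []      = refl
  -ᵛ-as-+ᵛ (a ∷ x) (b ∷ y) = cong₂ _∷_
    (solve 2 (λ a b → a :- b := a :+ (:- con (1 , 0)) :* b) refl a b) (-ᵛ-as-+ᵛ x y)

  +ᵛ-ᵛ-cancelˡ : (x y : 𝔽^ n) → (x +ᵛ y) -ᵛ x ≡ y
  +ᵛ-ᵛ-cancelˡ []      []      = refl
  +ᵛ-ᵛ-cancelˡ (a ∷ x) (b ∷ y) = cong₂ _∷_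
    (solve 2 (λ a b → (a :+ b) :- a := b) refl a b) (+ᵛ-ᵛ-cancelˡ x y)

  +ᵛ-ᵛ-cancel-common : (x y z : 𝔽^ n) → (x +ᵛ y) -ᵛ (x +ᵛ z) ≡ y -ᵛ z
  +ᵛ-ᵛ-cancel-common []      []      []      = refl
  +ᵛ-ᵛ-cancel-common (a ∷ x) (b ∷ y) (c ∷ z) = cong₂ _∷_
    (solve 3 (λ a b c → (a :+ b) :- (a :+ c) := b :- c) refl a b c) (+ᵛ-ᵛ-cancel-common x y z)

  x+[y-x]≡y : (x y : 𝔽^ n) → x +ᵛ (y -ᵛ x) ≡ y
  x+[y-x]≡y []      []      = refl
  x+[y-x]≡y (a ∷ x) (b ∷ y) = cong₂ _∷_
    (solve 2 (λ a b → a :+ (b :- a) := b) refl a b) (x+[y-x]≡y x y)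

  x-x≡0 : (x : 𝔽^ n) → x -ᵛ x ≡ 0ᵛ
  x-x≡0 []      = refl
  x-x≡0 (a ∷ x) = cong₂ _∷_ (solve 1 (λ a → a :- a := con (0 , 0)) refl a) (x-x≡0 x)

  x-y≡0⇒x≡y : (x y : 𝔽^ n) → x -ᵛ y ≡ 0ᵛ → x ≡ y
  x-y≡0⇒x≡y x y x-y≡0 = begin
    x               ≡⟨ sym (x+[y-x]≡y y x) ⟩
    y +ᵛ (x -ᵛ y)   ≡⟨ cong (y +ᵛ_) x-y≡0 ⟩
    y +ᵛ 0ᵛ         ≡⟨ +ᵛ-identityʳ y ⟩
    y               ∎

  •-cancel : ∀ {a} (x : 𝔽^ n) → a ≢ 0# → a • x ≡ 0ᵛ → x ≡ 0ᵛ
  •-cancel {a = a} x a≢0 ax≡0 = begin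
    x                 ≡⟨ sym (•-identity x) ⟩
    1# • x            ≡⟨ cong (_• x) (trans (sym (⁻¹-inverseʳ a a≢0)) (*-comm a (a ⁻¹))) ⟩
    (a ⁻¹ * a) • x    ≡⟨ •-assoc (a ⁻¹) a x ⟩
    a ⁻¹ • (a • x)    ≡⟨ cong (a ⁻¹ •_) ax≡0 ⟩
    a ⁻¹ • 0ᵛ         ≡⟨ •-zeroʳ (a ⁻¹) ⟩
    0ᵛ                ∎

  combination-zeroˡ : (xs : Vec (𝔽^ n) k) → combination 0ᵛ xs ≡ 0ᵛ
  combination-zeroˡ []       = refl
  combination-zeroˡ (x ∷ xs) =
    trans (cong₂ _+ᵛ_ (•-zeroˡ x) (combination-zeroˡ xs)) (+ᵛ-identityʳ 0ᵛ)

  combination-+ˡ : ∀ ts us (xs : Vec (𝔽^ n) k) →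
                   combination (ts +ᵛ us) xs ≡ combination ts xs +ᵛ combination us xs
  combination-+ˡ []       []       []       = sym (+ᵛ-identityʳ 0ᵛ)
  combination-+ˡ (t ∷ ts) (u ∷ us) (x ∷ xs) = trans
    (cong₂ _+ᵛ_ (•-distribʳ t u x) (combination-+ˡ ts us xs))
    (+ᵛ-interchange (t • x) (u • x) (combination ts xs) (combination us xs))

  combination-•ˡ : ∀ a ts (xs : Vec (𝔽^ n) k) → combination (a • ts) xs ≡ a • combination ts xs
  combination-•ˡ a []       []       = sym (•-zeroʳ a)
  combination-•ˡ a (t ∷ ts) (x ∷ xs) = trans
    (cong₂ _+ᵛ_ (•-assoc a t x) (combination-•ˡ a ts xs))
    (sym (•-distribˡ a (t • x) (combination ts xs)))

  Span-isSubspace : (xs : Vec (𝔽^ n) k) → IsSubspace (Span xs)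
  Span-isSubspace xs = record
    { 0-closed = 0ᵛ , sym (combination-zeroˡ xs)
    ; +-closed = λ { (ts , refl) (us , refl) → ts +ᵛ us , sym (combination-+ˡ ts us xs) }
    ; •-closed = λ { a (ts , refl) → a • ts , sym (combination-•ˡ a ts xs) }
    }

  -- Combinations are linear in the coefficients, so equal values give a relation whose coefficients
  -- are the difference `ts -ᵛ us`.
  combination-injective : (xs : Vec (𝔽^ n) k) → LinearlyIndependent xs →
                          Injective _≡_ _≡_ (λ ts → combination ts xs)
  combination-injective xs independent {ts} {us} eq = x-y≡0⇒x≡y ts us (independent (ts -ᵛ us) (begin
    combination (ts -ᵛ us) xs                               ≡⟨ cong (λ vs → combination vs xs) (-ᵛ-as-+ᵛ ts us) ⟩
    combination (ts +ᵛ (- 1#) • us) xs                      ≡⟨ combination-+ˡ ts ((- 1#) • us) xs ⟩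
    combination ts xs +ᵛ combination ((- 1#) • us) xs       ≡⟨ cong₂ _+ᵛ_ eq (combination-•ˡ (- 1#) us xs) ⟩
    combination us xs +ᵛ (- 1#) • combination us xs         ≡⟨ sym (-ᵛ-as-+ᵛ (combination us xs) (combination us xs)) ⟩
    combination us xs -ᵛ combination us xs                  ≡⟨ x-x≡0 (combination us xs) ⟩
    0ᵛ                                                      ∎))

  -- Counting takes the place of an exchange argument: sending coefficients to combinations embeds
  -- `Fin (q ^ k)` in `Fin (q ^ n)`, while `n < k` would make the target strictly smaller.
  dim≤ : 1 ℕ.< q → {U : Pred (𝔽^ n) 0ℓ} → HasDim U k → k ≤ n
  dim≤ {n = n} {k = k} 1<q (xs , independent , _) = ℕ.≮⇒≥ λ n<k →
    ℕ.<⇒≱ (ℕ.^-monoʳ-< q 1<q n<k) (Fin.injective⇒≤ (Injection.injective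
      (↣-trans (Inverse⇒Injection (↔-sym (Vec↔Fin enumeration k)))
      (↣-trans (mk↣ (combination-injective xs independent))
               (Inverse⇒Injection (Vec↔Fin enumeration n))))))

  -ᵛ-closed : {U : Pred (𝔽^ n) 0ℓ} → IsSubspace U → ∀ {u v} → u ∈ U → v ∈ U → u -ᵛ v ∈ U
  -ᵛ-closed {U = U} isSubspace {u} {v} u∈U v∈U =
    subst U (sym (-ᵛ-as-+ᵛ u v)) (+-closed u∈U (•-closed (- 1#) v∈U))
    where open IsSubspace isSubspace

  -- A direction vector is a difference of two points, `y +ᵛ u` and `y`. Written from `y′`, both
  -- points lie over vectors of `U′`, and the base point cancels.
  direction-⊆ : {y y′ : 𝔽^ n} {U U′ : Pred (𝔽^ n) 0ℓ} → IsSubspace U → IsSubspace U′ →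
                (y ⊕ U) ⊆ (y′ ⊕ U′) → U ⊆ U′
  direction-⊆ {y = y} {y′} {U} {U′} U-sub U′-sub ⊆′ {u} u∈U
    with ⊆′ (u , u∈U , refl) | ⊆′ (0ᵛ , IsSubspace.0-closed U-sub , sym (+ᵛ-identityʳ y))
  ... | v , v∈U′ , y+u≡y′+v | w , w∈U′ , y≡y′+w = subst U′
    (begin
      v -ᵛ w                       ≡⟨ sym (+ᵛ-ᵛ-cancel-common y′ v w) ⟩
      (y′ +ᵛ v) -ᵛ (y′ +ᵛ w)       ≡⟨ cong₂ _-ᵛ_ (sym y+u≡y′+v) (sym y≡y′+w) ⟩
      (y +ᵛ u) -ᵛ y                ≡⟨ +ᵛ-ᵛ-cancelˡ y u ⟩
      u                            ∎)
    (-ᵛ-closed U′-sub v∈U′ w∈U′)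

  HasDim-resp-≐ : {U U′ : Pred (𝔽^ n) 0ℓ} → U ≐ U′ → HasDim U k → HasDim U′ k
  HasDim-resp-≐ (U⊆U′ , U′⊆U) (xs , independent , U⊆Span , Span⊆U) =
    xs , independent , (λ u → U⊆Span (U′⊆U u)) , (λ u → U⊆U′ (Span⊆U u))

  singleton-independent : {v : 𝔽^ n} → v ≢ 0ᵛ → LinearlyIndependent (v ∷ [])
  singleton-independent {v = v} v≢0 (t ∷ []) tv≡0 with t ≟ 0#
  ... | yes refl = refl
  ... | no  t≢0  = contradiction (•-cancel v t≢0 (trans (sym (+ᵛ-identityʳ (t • v))) tv≡0)) v≢0

  independent-singleton-≢0 : {v : 𝔽^ n} → LinearlyIndependent (v ∷ []) → v ≢ 0ᵛ
  independent-singleton-≢0 {v = v} independent v≡0 = 0≢1 (sym (cong head (independent (1# ∷ [])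
    (trans (+ᵛ-identityʳ (1# • v)) (trans (•-identity v) v≡0)))))

  -- Passes from the barycentric form used for pencils to base point plus direction; the trailing
  -- zero in the solved identity is the empty tail of `combination`.
  join-as-⊕ : (x v : 𝔽^ n) → ∀ t →
              (1# - t) • x +ᵛ t • (x +ᵛ v) ≡ x +ᵛ combination (t ∷ []) (v ∷ [])
  join-as-⊕ []      []      t = refl
  join-as-⊕ (a ∷ x) (b ∷ v) t = cong₂ _∷_
    (solve 3 (λ a b t → (con (1 , 0) :- t) :* a :+ t :* (a :+ b) := a :+ (t :* b :+ con (0 , 0))) refl a b t)
    (join-as-⊕ x v t)

  -- Splitting off the last coordinate.

  ∷ʳ-init-last : (y : 𝔽^ (suc n)) → y ≡ init y ∷ʳ last y
  ∷ʳ-init-last {zero}  (a ∷ [])     = refl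
  ∷ʳ-init-last {suc n} (a ∷ b ∷ y) = cong (a ∷_) (∷ʳ-init-last (b ∷ y))

  ∷ʳ-+ᵛ : ∀ (x y : 𝔽^ n) a b → (x ∷ʳ a) +ᵛ (y ∷ʳ b) ≡ (x +ᵛ y) ∷ʳ (a + b)
  ∷ʳ-+ᵛ []      []      a b = refl
  ∷ʳ-+ᵛ (c ∷ x) (d ∷ y) a b = cong (c + d ∷_) (∷ʳ-+ᵛ x y a b)

  ∷ʳ-• : ∀ c (x : 𝔽^ n) a → c • (x ∷ʳ a) ≡ (c • x) ∷ʳ (c * a)
  ∷ʳ-• c x a = map-∷ʳ (c *_) a x

  0ᵛ-∷ʳ : ∀ n → 0ᵛ {suc n} ≡ 0ᵛ {n} ∷ʳ 0#
  0ᵛ-∷ʳ zero    = refl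
  0ᵛ-∷ʳ (suc n) = cong (0# ∷_) (0ᵛ-∷ʳ n)

  init-+ᵛ : (x y : 𝔽^ (suc n)) → init (x +ᵛ y) ≡ init x +ᵛ init y
  init-+ᵛ {zero}  (a ∷ [])    (b ∷ [])    = refl
  init-+ᵛ {suc n} (a ∷ c ∷ x) (b ∷ d ∷ y) = cong (a + b ∷_) (init-+ᵛ (c ∷ x) (d ∷ y))

  last-+ᵛ : (x y : 𝔽^ (suc n)) → last (x +ᵛ y) ≡ last x + last y
  last-+ᵛ {zero}  (a ∷ [])    (b ∷ [])    = refl
  last-+ᵛ {suc n} (a ∷ c ∷ x) (b ∷ d ∷ y) = last-+ᵛ (c ∷ x) (d ∷ y)

  init-• : ∀ a (x : 𝔽^ (suc n)) → init (a • x) ≡ a • init x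
  init-• {zero}  a (b ∷ [])    = refl
  init-• {suc n} a (b ∷ c ∷ x) = cong (a * b ∷_) (init-• a (c ∷ x))

  last-• : ∀ a (x : 𝔽^ (suc n)) → last (a • x) ≡ a * last x
  last-• {zero}  a (b ∷ [])    = refl
  last-• {suc n} a (b ∷ c ∷ x) = last-• a (c ∷ x)

  init-combination : ∀ ts (xs : Vec (𝔽^ (suc n)) k) →
                     combination ts (Vec.map init xs) ≡ init (combination ts xs)
  init-combination {n = n} []       []       =
    sym (trans (cong init (0ᵛ-∷ʳ n)) (init-∷ʳ 0# 0ᵛ))
  init-combination {n = n} (t ∷ ts) (x ∷ xs) = sym (begin
    init (t • x +ᵛ combination ts xs)            ≡⟨ init-+ᵛ (t • x) (combination ts xs) ⟩
    init (t • x) +ᵛ init (combination ts xs)     ≡⟨ cong₂ _+ᵛ_ (init-• t x) (sym (init-combination ts xs)) ⟩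
    t • init x +ᵛ combination ts (Vec.map init xs)   ∎)

-- Halving and the bilinear form.

module SphereProperties {q : ℕ} (F : FiniteField q) (2#≢0# : FiniteField.2# F ≢ FiniteField.0# F)
                        {d : ℕ} (Q : LinearAlgebra.QuadraticForm F d) where
  open FiniteField F
  open LinearAlgebra F
  open QuadraticForm Q
  open SphereGeometry F Q
  open CommutativeRing commutativeRing
    using (ring; +-identityʳ; zeroˡ; *-identityˡ)
  open import Algebra.Properties.Ring ring
    using (x∙y⁻¹≈ε⇒x≈y; x≈y⇒x∙y⁻¹≈ε; -‿distribʳ-*; -0#≈0#; -‿involutive;
           +-inverseˡ-unique; +-inverseʳ-unique; +-identityʳ-unique)
  open IntegerRingSolver F
  open FieldProperties F
  open VectorProperties F
  open ≡-Reasoning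

  2*2⁻¹≡1 : 2# * 2# ⁻¹ ≡ 1#
  2*2⁻¹≡1 = ⁻¹-inverseʳ 2# 2#≢0#

  -- Homogeneity turns a half-shift of the centre into a squared half, whereas `sphereSystem`
  -- divides by `4#`; this reconciles the two.
  4⁻¹≡2⁻¹*2⁻¹ : 4# ⁻¹ ≡ 2# ⁻¹ * 2# ⁻¹
  4⁻¹≡2⁻¹*2⁻¹ = ⁻¹-unique 4# (2# ⁻¹ * 2# ⁻¹) (begin
    4# * (2# ⁻¹ * 2# ⁻¹)          ≡⟨ solve 2 (λ a h → (a :* a) :* (h :* h) := (a :* h) :* (a :* h)) refl 2# (2# ⁻¹) ⟩
    (2# * 2# ⁻¹) * (2# * 2# ⁻¹)   ≡⟨ cong₂ _*_ 2*2⁻¹≡1 2*2⁻¹≡1 ⟩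
    1# * 1#                       ≡⟨ *-identityˡ 1# ⟩
    1#                            ∎)

  2•2⁻¹• : ∀ {n} (x : 𝔽^ n) → 2# • (2# ⁻¹ • x) ≡ x
  2•2⁻¹• x = trans (sym (•-assoc 2# (2# ⁻¹) x)) (trans (cong (_• x) 2*2⁻¹≡1) (•-identity x))

  form-+ᵛ : ∀ x y → form (x +ᵛ y) ≡ polar x y + form x + form y
  form-+ᵛ x y = solve 3 (λ a b c → a := (a :- b :- c) :+ b :+ c) refl (form (x +ᵛ y)) (form x) (form y)

  polar-sym : ∀ x y → polar x y ≡ polar y x
  polar-sym x y = trans
    (cong (λ z → form z - form x - form y) (+ᵛ-comm x y))
    (solve 3 (λ a b c → a :- b :- c := a :- c :- b) refl (form (y +ᵛ x)) (form x) (form y))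

  polar-•ʳ : ∀ a x y → polar x (a • y) ≡ a * polar x y
  polar-•ʳ a x y = trans (polar-sym x (a • y)) (trans (polar-•ˡ a y x) (cong (a *_) (polar-sym y x)))

  ⟨⟩-+ˡ : ∀ x y z → ⟨ x +ᵛ y , z ⟩ ≡ ⟨ x , z ⟩ + ⟨ y , z ⟩
  ⟨⟩-+ˡ x y z = trans (cong (_* 2# ⁻¹) (polar-+ˡ x y z))
    (solve 3 (λ a b h → (a :+ b) :* h := a :* h :+ b :* h) refl (polar x z) (polar y z) (2# ⁻¹))

  ⟨⟩-sym : ∀ x y → ⟨ x , y ⟩ ≡ ⟨ y , x ⟩
  ⟨⟩-sym x y = cong (_* 2# ⁻¹) (polar-sym x y)

  ⟨⟩-+ʳ : ∀ x y z → ⟨ x , y +ᵛ z ⟩ ≡ ⟨ x , y ⟩ + ⟨ x , z ⟩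
  ⟨⟩-+ʳ x y z = trans (⟨⟩-sym x (y +ᵛ z)) (trans (⟨⟩-+ˡ y z x) (cong₂ _+_ (⟨⟩-sym y x) (⟨⟩-sym z x)))

  ⟨⟩-•ʳ : ∀ a x y → ⟨ x , a • y ⟩ ≡ a * ⟨ x , y ⟩
  ⟨⟩-•ʳ a x y = trans (cong (_* 2# ⁻¹) (polar-•ʳ a x y))
    (solve 3 (λ a p h → (a :* p) :* h := a :* (p :* h)) refl a (polar x y) (2# ⁻¹))

  ⟨⟩-zeroʳ : ∀ x → ⟨ x , 0ᵛ ⟩ ≡ 0#
  ⟨⟩-zeroʳ x = begin
    ⟨ x , 0ᵛ ⟩          ≡⟨ cong ⟨ x ,_⟩ (sym (•-zeroˡ 0ᵛ)) ⟩
    ⟨ x , 0# • 0ᵛ ⟩     ≡⟨ ⟨⟩-•ʳ 0# x 0ᵛ ⟩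
    0# * ⟨ x , 0ᵛ ⟩     ≡⟨ zeroˡ ⟨ x , 0ᵛ ⟩ ⟩
    0#                  ∎

  form--ᵛ : ∀ x c → form (x -ᵛ c) ≡ form x + form c - polar x c
  form--ᵛ x c = begin
    form (x -ᵛ c)
      ≡⟨ cong form (-ᵛ-as-+ᵛ x c) ⟩
    form (x +ᵛ (- 1#) • c)
      ≡⟨ form-+ᵛ x ((- 1#) • c) ⟩
    polar x ((- 1#) • c) + form x + form ((- 1#) • c)
      ≡⟨ cong₂ (λ a b → a + form x + b) (polar-•ʳ (- 1#) x c) (homogeneous (- 1#) c) ⟩
    (- 1#) * polar x c + form x + (- 1#) * (- 1#) * form c
      ≡⟨ solve 3 (λ p a b → (:- con (1 , 0)) :* p :+ a :+ (:- con (1 , 0)) :* (:- con (1 , 0)) :* b := a :+ b :- p) refl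
           (polar x c) (form x) (form c) ⟩
    form x + form c - polar x c ∎

  -- The lift and its incidence function.

  ℓ : 𝔽^ d → 𝔽^ (suc d) → Carrier
  ℓ x y = ⟨ x , init y ⟩ + last y

  Λ-ℓ : ∀ x y → Λ x y ≡ form x - ℓ x y
  Λ-ℓ x y = solve 3 (λ a b c → a :- b :- c := a :- (b :+ c)) refl (form x) ⟨ x , init y ⟩ (last y)

  ℓ-+ᵛ : ∀ x y z → ℓ x (y +ᵛ z) ≡ ℓ x y + ℓ x z
  ℓ-+ᵛ x y z = trans
    (cong₂ _+_ (trans (cong ⟨ x ,_⟩ (init-+ᵛ y z)) (⟨⟩-+ʳ x (init y) (init z))) (last-+ᵛ y z))
    (solve 4 (λ a b c e → (a :+ b) :+ (c :+ e) := (a :+ c) :+ (b :+ e)) refl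
      ⟨ x , init y ⟩ ⟨ x , init z ⟩ (last y) (last z))

  ℓ-• : ∀ x a y → ℓ x (a • y) ≡ a * ℓ x y
  ℓ-• x a y = trans
    (cong₂ _+_ (trans (cong ⟨ x ,_⟩ (init-• a y)) (⟨⟩-•ʳ a x (init y))) (last-• a y))
    (solve 3 (λ a b c → a :* b :+ a :* c := a :* (b :+ c)) refl a ⟨ x , init y ⟩ (last y))

  ℓ-∷ʳ : ∀ x w a → ℓ x (w ∷ʳ a) ≡ ⟨ x , w ⟩ + a
  ℓ-∷ʳ x w a = cong₂ (λ u b → ⟨ x , u ⟩ + b) (init-∷ʳ a w) (last-∷ʳ a w)

  ℓ-zero : ∀ x → ℓ x 0ᵛ ≡ 0#
  ℓ-zero x = trans (cong (ℓ x) (sym (•-zeroˡ 0ᵛ))) (trans (ℓ-• x 0# 0ᵛ) (zeroˡ (ℓ x 0ᵛ)))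

  Λ-Φ : ∀ x c r → Λ x (Φ (c , r)) ≡ form (x -ᵛ c) - r
  Λ-Φ x c r = begin
    Λ x (Φ (c , r))
      ≡⟨ Λ-ℓ x (Φ (c , r)) ⟩
    form x - ℓ x (Φ (c , r))
      ≡⟨ cong (λ a → form x - a) (trans (ℓ-∷ʳ x (2# • c) (r - form c)) (cong (_+ (r - form c)) ⟨x,2c⟩)) ⟩
    form x - (polar x c + (r - form c))
      ≡⟨ solve 4 (λ a p r b → a :- (p :+ (r :- b)) := a :+ b :- p :- r) refl (form x) (polar x c) r (form c) ⟩
    form x + form c - polar x c - r
      ≡⟨ cong (_- r) (sym (form--ᵛ x c)) ⟩
    form (x -ᵛ c) - r ∎
    where
    -- The factor `2#` in the lift cancels the division by `2#` in the bracket, leaving the cross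
    -- term of `form (x -ᵛ c)`.
    ⟨x,2c⟩ : ⟨ x , 2# • c ⟩ ≡ polar x c
    ⟨x,2c⟩ = begin
      ⟨ x , 2# • c ⟩              ≡⟨ ⟨⟩-•ʳ 2# x c ⟩
      2# * (polar x c * 2# ⁻¹)    ≡⟨ solve 3 (λ a p h → a :* (p :* h) := (a :* h) :* p) refl 2# (polar x c) (2# ⁻¹) ⟩
      (2# * 2# ⁻¹) * polar x c    ≡⟨ cong (_* polar x c) 2*2⁻¹≡1 ⟩
      1# * polar x c              ≡⟨ *-identityˡ (polar x c) ⟩
      polar x c                   ∎

  ∈points⇒Λ≡0 : ∀ {x} S → x ∈ points S → Λ x (Φ S) ≡ 0#
  ∈points⇒Λ≡0 {x} (c , r) x∈S = trans (Λ-Φ x c r) (x≈y⇒x∙y⁻¹≈ε x∈S)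

  Λ≡0⇒∈points : ∀ {x} S → Λ x (Φ S) ≡ 0# → x ∈ points S
  Λ≡0⇒∈points {x} (c , r) Λ≡0 = x∙y⁻¹≈ε⇒x≈y _ _ (trans (sym (Λ-Φ x c r)) Λ≡0)

  Φ⁻¹ : 𝔽^ (suc d) → Sphere
  Φ⁻¹ y = 2# ⁻¹ • init y , last y + form (2# ⁻¹ • init y)

  -- Every point of `𝔽^ (suc d)` is thus a lift, so statements about points of `L` can be read as
  -- statements about spheres of `𝒮 L`.
  Φ-Φ⁻¹ : ∀ y → Φ (Φ⁻¹ y) ≡ y
  Φ-Φ⁻¹ y = trans
    (cong₂ _∷ʳ_ (2•2⁻¹• (init y))
      (solve 2 (λ a b → (a :+ b) :- b := a) refl (last y) (form (2# ⁻¹ • init y))))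
    (sym (∷ʳ-init-last y))

  -- Halving recovers the centre; the subtracted values `form c` and `form c′` then agree, and the
  -- last coordinates give the radii.
  Φ-injective : Injective _≡_ _≡_ Φ
  Φ-injective {c , r} {c′ , r′} eq with ∷ʳ-injective (2# • c) (2# • c′) eq
  ... | 2c≡2c′ , r-Qc≡r′-Qc′ = cong₂ _,_ c≡c′ r≡r′
    where
    halve : ∀ x → 2# ⁻¹ • (2# • x) ≡ x
    halve x = trans (sym (•-assoc (2# ⁻¹) 2# x))
      (trans (cong (_• x) (solve 2 (λ a h → h :* a := a :* h) refl 2# (2# ⁻¹)))
      (trans (•-assoc 2# (2# ⁻¹) x) (2•2⁻¹• x)))

    c≡c′ : c ≡ c′
    c≡c′ = trans (sym (halve c)) (trans (cong (2# ⁻¹ •_) 2c≡2c′) (halve c′))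

    r≡r′ : r ≡ r′
    r≡r′ = begin
      r                            ≡⟨ solve 2 (λ a b → a := (a :- b) :+ b) refl r (form c) ⟩
      (r - form c) + form c        ≡⟨ cong₂ _+_ r-Qc≡r′-Qc′ (cong form c≡c′) ⟩
      (r′ - form c′) + form c′     ≡⟨ solve 2 (λ a b → (a :- b) :+ b := a) refl r′ (form c′) ⟩
      r′                           ∎

  -- This explains the radius in `sphereSystem`: `⟨ c₀ , w ⟩ + form w / 4#` is exactly the growth of
  -- `form` from `c₀` to the new centre, so subtracting `form` of the centre in `Φ` leaves only `b`.
  Φ-shift : ∀ c₀ r₀ w b →
            Φ (c₀ +ᵛ 2# ⁻¹ • w , r₀ + b + ⟨ c₀ , w ⟩ + form w / 4#) ≡ Φ (c₀ , r₀) +ᵛ (w ∷ʳ b)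
  Φ-shift c₀ r₀ w b = sym (trans (∷ʳ-+ᵛ (2# • c₀) w (r₀ - form c₀) b) (cong₂ _∷ʳ_
    (sym (trans (•-distribˡ 2# c₀ (2# ⁻¹ • w)) (cong (2# • c₀ +ᵛ_) (2•2⁻¹• w))))
    (sym (begin
      r₀ + b + ⟨ c₀ , w ⟩ + form w * 4# ⁻¹ - form (c₀ +ᵛ 2# ⁻¹ • w)
        ≡⟨ cong₂ (λ s t → r₀ + b + ⟨ c₀ , w ⟩ + form w * s - t) 4⁻¹≡2⁻¹*2⁻¹ form-shift ⟩
      r₀ + b + polar c₀ w * 2# ⁻¹ + form w * (2# ⁻¹ * 2# ⁻¹) - (2# ⁻¹ * polar c₀ w + form c₀ + 2# ⁻¹ * 2# ⁻¹ * form w)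
        ≡⟨ solve 6 (λ r b p h a e → r :+ b :+ p :* h :+ a :* (h :* h) :- (h :* p :+ e :+ h :* h :* a) := (r :- e) :+ b) refl
             r₀ b (polar c₀ w) (2# ⁻¹) (form w) (form c₀) ⟩
      (r₀ - form c₀) + b ∎))))
    where
    form-shift : form (c₀ +ᵛ 2# ⁻¹ • w) ≡ 2# ⁻¹ * polar c₀ w + form c₀ + 2# ⁻¹ * 2# ⁻¹ * form w
    form-shift = trans (form-+ᵛ c₀ (2# ⁻¹ • w))
      (cong₂ (λ s t → s + form c₀ + t) (polar-•ʳ (2# ⁻¹) c₀ w) (homogeneous (2# ⁻¹) w))

  -- Affine spans, complete incidence and base loci.

  -- The weights are left unnormalised so that the induction applies to their tails; the sum is set
  -- to `1#` only in `B-aff`.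
  ℓ-combination : ∀ {k x a} ts (ys : Vec (𝔽^ (suc d)) k) → All (λ y → ℓ x y ≡ a) ys →
                  ℓ x (combination ts ys) ≡ sum ts * a
  ℓ-combination {x = x} {a} []       []       []          = trans (ℓ-zero x) (sym (zeroˡ a))
  ℓ-combination {x = x} {a} (t ∷ ts) (y ∷ ys) (eq ∷ eqs) = begin
    ℓ x (t • y +ᵛ combination ts ys)          ≡⟨ ℓ-+ᵛ x (t • y) (combination ts ys) ⟩
    ℓ x (t • y) + ℓ x (combination ts ys)     ≡⟨ cong₂ _+_ (trans (ℓ-• x t y) (cong (t *_) eq)) (ℓ-combination ts ys eqs) ⟩
    t * a + sum ts * a                        ≡⟨ solve 3 (λ t s a → t :* a :+ s :* a := (t :+ s) :* a) refl t (sum ts) a ⟩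
    (t + sum ts) * a                          ∎

  Λ≡0⇒ℓ≡form : ∀ x y → Λ x y ≡ 0# → ℓ x y ≡ form x
  Λ≡0⇒ℓ≡form x y Λ≡0 = sym (x∙y⁻¹≈ε⇒x≈y _ _ (trans (sym (Λ-ℓ x y)) Λ≡0))

  ℓ≡form⇒Λ≡0 : ∀ x y → ℓ x y ≡ form x → Λ x y ≡ 0#
  ℓ≡form⇒Λ≡0 x y ℓ≡form = trans (Λ-ℓ x y) (x≈y⇒x∙y⁻¹≈ε (sym ℓ≡form))

  -- Both points give `ℓ x` the same value `form x`, so its value on their difference is zero.
  ℓ-difference : ∀ {x y u} → Λ x y ≡ 0# → Λ x (y +ᵛ u) ≡ 0# → ℓ x u ≡ 0#
  ℓ-difference {x} {y} {u} Λy≡0 Λy+u≡0 = +-identityʳ-unique (ℓ x y) (ℓ x u) (begin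
    ℓ x y + ℓ x u   ≡⟨ sym (ℓ-+ᵛ x y u) ⟩
    ℓ x (y +ᵛ u)    ≡⟨ Λ≡0⇒ℓ≡form x (y +ᵛ u) Λy+u≡0 ⟩
    form x          ≡⟨ sym (Λ≡0⇒ℓ≡form x y Λy≡0) ⟩
    ℓ x y           ∎)

  B-aff : ∀ {X : Pred (𝔽^ (suc d)) 0ℓ} {x} → (∀ y → y ∈ X → Λ x y ≡ 0#) → x ∈ B (aff X)
  B-aff {x = x} Λ≡0 y (k , ys , ts , ys⊆X , sum≡1 , refl) = ℓ≡form⇒Λ≡0 x y (begin
    ℓ x (combination ts ys)   ≡⟨ ℓ-combination ts ys (All.map (λ {y} y∈X → Λ≡0⇒ℓ≡form x y (Λ≡0 y y∈X)) ys⊆X) ⟩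
    sum ts * form x           ≡⟨ cong (_* form x) sum≡1 ⟩
    1# * form x               ≡⟨ *-identityˡ (form x) ⟩
    form x                    ∎)

  ⊆aff : ∀ {n} {X : Pred (𝔽^ n) 0ℓ} → X ⊆ aff X
  ⊆aff {x = y} y∈X = 1 , y ∷ [] , 1# ∷ [] , y∈X ∷ [] , +-identityʳ 1# ,
    sym (trans (+ᵛ-identityʳ (1# • y)) (•-identity y))

  incidences-complete : ∀ P 𝒯 → (incidences P 𝒯 ≡ length P ℕ.* length 𝒯) ⇔
                                (∀ {x S} → x ∈ₗ P → S ∈ₗ 𝒯 → x ∈ points S)
  incidences-complete = length-filter-cartesianProduct incident?

  -- Complete incidence is vanishing of `Λ` on the listed lifts, which extends to their affine span.
  -- Conversely each `Φ S` is itself a point of the span, where membership in `B` can be evaluated.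
  incidences-aff : ∀ P 𝒯 → let L = aff (_∈ₗ map Φ 𝒯) in
                   (incidences P 𝒯 ≡ length P ℕ.* length 𝒯) ⇔ ((_∈ₗ P) ⊆ B L × (_∈ₗ 𝒯) ⊆ 𝒮 L)
  incidences-aff P 𝒯 = mk⇔
    (λ full →
      (λ {x} x∈P → B-aff λ y y∈Φ𝒯 → case ∈-map⁻ Φ y∈Φ𝒯 of λ
        { (S , S∈𝒯 , refl) → ∈points⇒Λ≡0 S (Equivalence.to (incidences-complete P 𝒯) full x∈P S∈𝒯) }) ,
      (λ {S} S∈𝒯 → ⊆aff (∈-map⁺ Φ S∈𝒯)))
    (λ (P⊆B , 𝒯⊆𝒮) → Equivalence.from (incidences-complete P 𝒯)
      (λ {x} {S} x∈P S∈𝒯 → Λ≡0⇒∈points S (P⊆B x∈P (Φ S) (𝒯⊆𝒮 S∈𝒯))))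

  -- `B` quantifies over points of `L` and not over spheres; surjectivity of `Φ` supplies a sphere
  -- of `𝒮 L` above each point.
  commonPoints-𝒮 : ∀ L → commonPoints (𝒮 L) ≐ B L
  commonPoints-𝒮 L =
    (λ {x} common y y∈L → subst (λ y → Λ x y ≡ 0#) (Φ-Φ⁻¹ y)
      (∈points⇒Λ≡0 (Φ⁻¹ y) (common (Φ⁻¹ y) (subst L (sym (Φ-Φ⁻¹ y)) y∈L)))) ,
    (λ x∈B S ΦS∈L → Λ≡0⇒∈points S (x∈B (Φ S) ΦS∈L))

  -- Sphere systems as preimages of translated graphs.

  module _ {W : Pred (𝔽^ d) 0ℓ} (β : LinearFunctional W) where
    open LinearFunctional β

    graph-isSubspace : IsSubspace W → IsSubspace (graph W β)
    graph-isSubspace W-sub = record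
      -- The value of a functional at zero has to come from `•-homo`, hence the presentation of the
      -- zero vector as `0# • 0ᵛ`.
      { 0-closed = 0# • 0ᵛ , •-closed 0# 0-closed , (begin
          0ᵛ                                    ≡⟨ 0ᵛ-∷ʳ d ⟩
          0ᵛ ∷ʳ 0#                              ≡⟨ cong₂ _∷ʳ_ (sym (•-zeroˡ 0ᵛ)) (sym (zeroˡ (to 0ᵛ 0-closed))) ⟩
          (0# • 0ᵛ) ∷ʳ (0# * to 0ᵛ 0-closed)    ≡⟨ cong ((0# • 0ᵛ) ∷ʳ_) (sym (•-homo 0# 0-closed _)) ⟩
          (0# • 0ᵛ) ∷ʳ to (0# • 0ᵛ) _           ∎)
      ; +-closed = λ { (v , v∈W , refl) (w , w∈W , refl) →
          v +ᵛ w , +-closed v∈W w∈W ,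
          trans (∷ʳ-+ᵛ v w (to v v∈W) (to w w∈W)) (cong ((v +ᵛ w) ∷ʳ_) (sym (+-homo v∈W w∈W _))) }
      ; •-closed = λ { a (w , w∈W , refl) →
          a • w , •-closed a w∈W ,
          trans (∷ʳ-• a w (to w w∈W)) (cong ((a • w) ∷ʳ_) (sym (•-homo a w∈W _))) }
      }
      where open IsSubspace W-sub

    -- `Φ-shift` computes the lift of each member of the system; injectivity of `Φ` then identifies
    -- any sphere having such a lift with that member.
    𝒮-graph : ∀ c₀ r₀ → sphereSystem c₀ r₀ W β ≐ 𝒮 (Φ (c₀ , r₀) ⊕ graph W β)
    𝒮-graph c₀ r₀ =
      (λ { (w , w∈W , refl) → _ , (w , w∈W , refl) , Φ-shift c₀ r₀ w (to w w∈W) }) ,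
      (λ { (_ , (w , w∈W , refl) , ΦS≡) →
           w , w∈W , Φ-injective (trans ΦS≡ (sym (Φ-shift c₀ r₀ w (to w w∈W)))) })

    -- Vanishing at the base point puts `x` on the initial sphere. Vanishing on the rest of the
    -- coset means that `⟨ x , w ⟩` is minus the value of `β` at `w`, which is `⟨ z , w ⟩`; so
    -- `x -ᵛ z` is orthogonal to `W`.
    B-graph : ∀ c₀ r₀ z → IsSubspace W → (∀ w (w∈W : w ∈ W) → ⟨ z , w ⟩ ≡ - to w w∈W) →
              B (Φ (c₀ , r₀) ⊕ graph W β) ≐ (points (c₀ , r₀) ∩ (z ⊕ W ⊥))
    B-graph c₀ r₀ z W-sub ⟨z,⟩≡-β = B⊆ , ⊆B
      where
      y₀ : 𝔽^ (suc d)
      y₀ = Φ (c₀ , r₀)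

      B⊆ : B (y₀ ⊕ graph W β) ⊆ (points (c₀ , r₀) ∩ (z ⊕ W ⊥))
      B⊆ {x} x∈B = Λ≡0⇒∈points (c₀ , r₀) Λy₀≡0 , x -ᵛ z , x-z∈W⊥ , sym (x+[y-x]≡y z x)
        where
        Λy₀≡0 : Λ x y₀ ≡ 0#
        Λy₀≡0 = x∈B y₀ (0ᵛ , IsSubspace.0-closed (graph-isSubspace W-sub) , sym (+ᵛ-identityʳ y₀))

        x-z∈W⊥ : (x -ᵛ z) ∈ W ⊥
        x-z∈W⊥ w w∈W = begin
          ⟨ x -ᵛ z , w ⟩                ≡⟨ solve 2 (λ a b → a := (b :+ a) :- b) refl ⟨ x -ᵛ z , w ⟩ ⟨ z , w ⟩ ⟩
          (⟨ z , w ⟩ + ⟨ x -ᵛ z , w ⟩) - ⟨ z , w ⟩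
                                        ≡⟨ cong (_- ⟨ z , w ⟩) (trans (sym (⟨⟩-+ˡ z (x -ᵛ z) w)) (cong ⟨_, w ⟩ (x+[y-x]≡y z x))) ⟩
          ⟨ x , w ⟩ - ⟨ z , w ⟩         ≡⟨ x≈y⇒x∙y⁻¹≈ε (trans ⟨x,w⟩≡-β (sym (⟨z,⟩≡-β w w∈W))) ⟩
          0#                            ∎
          where
          u : 𝔽^ (suc d)
          u = w ∷ʳ to w w∈W

          ⟨x,w⟩≡-β : ⟨ x , w ⟩ ≡ - to w w∈W
          ⟨x,w⟩≡-β = +-inverseˡ-unique _ _ (trans (sym (ℓ-∷ʳ x w (to w w∈W)))
            (ℓ-difference Λy₀≡0 (x∈B (y₀ +ᵛ u) (u , (w , w∈W , refl) , refl))))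

      ⊆B : (points (c₀ , r₀) ∩ (z ⊕ W ⊥)) ⊆ B (y₀ ⊕ graph W β)
      ⊆B {x} (x∈S , v , v∈W⊥ , refl) _ (_ , (w , w∈W , refl) , refl) = ℓ≡form⇒Λ≡0 x (y₀ +ᵛ u) (begin
        ℓ x (y₀ +ᵛ u)        ≡⟨ ℓ-+ᵛ x y₀ u ⟩
        ℓ x y₀ + ℓ x u       ≡⟨ cong₂ _+_ (Λ≡0⇒ℓ≡form x y₀ (∈points⇒Λ≡0 (c₀ , r₀) x∈S)) ℓu≡0 ⟩
        form x + 0#          ≡⟨ +-identityʳ (form x) ⟩
        form x               ∎)
        where
        u : 𝔽^ (suc d)
        u = w ∷ʳ to w w∈W

        ℓu≡0 : ℓ (z +ᵛ v) u ≡ 0#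
        ℓu≡0 = begin
          ℓ (z +ᵛ v) u                          ≡⟨ ℓ-∷ʳ (z +ᵛ v) w (to w w∈W) ⟩
          ⟨ z +ᵛ v , w ⟩ + to w w∈W             ≡⟨ cong (_+ to w w∈W) (⟨⟩-+ˡ z v w) ⟩
          ⟨ z , w ⟩ + ⟨ v , w ⟩ + to w w∈W      ≡⟨ cong₂ (λ a b → a + b + to w w∈W) (⟨z,⟩≡-β w w∈W) (v∈W⊥ w w∈W) ⟩
          - to w w∈W + 0# + to w w∈W            ≡⟨ solve 1 (λ a → :- a :+ con (0 , 0) :+ a := con (0 , 0)) refl (to w w∈W) ⟩
          0#                                    ∎

  -- Directions of affine subspaces with nonempty base.

  module _ {U : Pred (𝔽^ (suc d)) 0ℓ} (U-sub : IsSubspace U) {y₀ : 𝔽^ (suc d)} {x : 𝔽^ d}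
           (x∈B : x ∈ B (y₀ ⊕ U)) where
    private module U = IsSubspace U-sub

    -- This is the image of `U` under `init`, encoded without an existential: the point `x` already
    -- dictates the missing coordinate. Membership in `W` is then literally membership in `U`, and
    -- `β` can ignore the proof it receives.
    W : Pred (𝔽^ d) 0ℓ
    W w = (w ∷ʳ (- ⟨ x , w ⟩)) ∈ U

    -⟨x,⟩-+ᵛ : ∀ v w → - ⟨ x , v +ᵛ w ⟩ ≡ - ⟨ x , v ⟩ - ⟨ x , w ⟩
    -⟨x,⟩-+ᵛ v w = trans (cong -_ (⟨⟩-+ʳ x v w))
      (solve 2 (λ a b → :- (a :+ b) := :- a :- b) refl ⟨ x , v ⟩ ⟨ x , w ⟩)

    -⟨x,⟩-• : ∀ a w → - ⟨ x , a • w ⟩ ≡ a * - ⟨ x , w ⟩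
    -⟨x,⟩-• a w = trans (cong -_ (⟨⟩-•ʳ a x w)) (-‿distribʳ-* a ⟨ x , w ⟩)

    β : LinearFunctional W
    β = record
      { to         = λ w _ → - ⟨ x , w ⟩
      ; irrelevant = λ _ _ → refl
      ; +-homo     = λ {v} {w} _ _ _ → -⟨x,⟩-+ᵛ v w
      ; •-homo     = λ a {w} _ _ → -⟨x,⟩-• a w
      }

    ∈U⇒graph : ∀ {u} → u ∈ U → u ≡ init u ∷ʳ (- ⟨ x , init u ⟩)
    ∈U⇒graph {u} u∈U = trans (∷ʳ-init-last u) (cong (init u ∷ʳ_)
      (+-inverseʳ-unique ⟨ x , init u ⟩ (last u)
        (ℓ-difference (x∈B y₀ (0ᵛ , U.0-closed , sym (+ᵛ-identityʳ y₀))) (x∈B (y₀ +ᵛ u) (u , u∈U , refl)))))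

    init∈W : ∀ {u} → u ∈ U → init u ∈ W
    init∈W u∈U = subst U (∈U⇒graph u∈U) u∈U

    U≐graph : U ≐ graph W β
    U≐graph = (λ {u} u∈U → init u , init∈W u∈U , ∈U⇒graph u∈U) ,
              (λ { (w , w∈W , refl) → w∈W })

    W-isSubspace : IsSubspace W
    W-isSubspace = record
      { 0-closed = subst U (trans (0ᵛ-∷ʳ d) (cong (0ᵛ ∷ʳ_) (sym -⟨x,0⟩≡0))) U.0-closed
      ; +-closed = λ {v} {w} v∈W w∈W → subst U
          (trans (∷ʳ-+ᵛ v w _ _) (cong ((v +ᵛ w) ∷ʳ_) (sym (-⟨x,⟩-+ᵛ v w)))) (U.+-closed v∈W w∈W)
      ; •-closed = λ a {w} w∈W → subst U
          (trans (∷ʳ-• a w _) (cong ((a • w) ∷ʳ_) (sym (-⟨x,⟩-• a w)))) (U.•-closed a w∈W)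
      }
      where
      -⟨x,0⟩≡0 : - ⟨ x , 0ᵛ ⟩ ≡ 0#
      -⟨x,0⟩≡0 = trans (cong -_ (⟨⟩-zeroʳ x)) -0#≈0#

    -- On `U` the last coordinate is a function of the others that vanishes at zero, so the
    -- projection has trivial kernel; this is why a basis of `U` projects to a basis of `W`.
    init≡0⇒≡0 : ∀ {u} → u ∈ U → init u ≡ 0ᵛ → u ≡ 0ᵛ
    init≡0⇒≡0 {u} u∈U init≡0 = begin
      u                                  ≡⟨ ∈U⇒graph u∈U ⟩
      init u ∷ʳ (- ⟨ x , init u ⟩)       ≡⟨ cong (λ w → w ∷ʳ (- ⟨ x , w ⟩)) init≡0 ⟩
      0ᵛ ∷ʳ (- ⟨ x , 0ᵛ ⟩)               ≡⟨ cong (λ a → 0ᵛ ∷ʳ (- a)) (⟨⟩-zeroʳ x) ⟩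
      0ᵛ ∷ʳ (- 0#)                       ≡⟨ cong (0ᵛ ∷ʳ_) -0#≈0# ⟩
      0ᵛ ∷ʳ 0#                           ≡⟨ sym (0ᵛ-∷ʳ d) ⟩
      0ᵛ                                 ∎

    W-hasDim : ∀ {r} → HasDim U r → HasDim W r
    W-hasDim (us , independent , U⊆Span , Span⊆U) =
      Vec.map init us ,
      (λ ts eq → independent ts
        (init≡0⇒≡0 (Span⊆U (ts , refl)) (trans (sym (init-combination ts us)) eq))) ,
      (λ {w} w∈W → case U⊆Span w∈W of λ (ts , eq) → ts , (begin
        w                                 ≡⟨ sym (init-∷ʳ (- ⟨ x , w ⟩) w) ⟩
        init (w ∷ʳ (- ⟨ x , w ⟩))         ≡⟨ cong init eq ⟩
        init (combination ts us)          ≡⟨ sym (init-combination ts us) ⟩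
        combination ts (Vec.map init us)      ∎)) ,
      (λ { (ts , refl) → subst W (sym (init-combination ts us)) (init∈W (Span⊆U (ts , refl))) })

  B-antitone : ∀ {L L′ : Pred (𝔽^ (suc d)) 0ℓ} → L ⊆ L′ → B L′ ⊆ B L
  B-antitone L⊆L′ x∈B y y∈L = x∈B y (L⊆L′ y∈L)

  direction-parametrisation : ∀ {L} → Satisfiable (B L) → ∀ {r} → HasAffineDim L r →
    ∀ y₀ U → IsSubspace U → L ≐ y₀ ⊕ U → ∀ c₀ r₀ → y₀ ≡ Φ (c₀ , r₀) →
    Σ (Pred (𝔽^ d) 0ℓ) λ W → IsSubspace W × HasDim W r ×
    Σ (LinearFunctional W) λ β →
    Σ (𝔽^ d) λ z →
      (∀ w (w∈W : w ∈ W) → ⟨ z , w ⟩ ≡ - LinearFunctional.to β w w∈W) ×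
      𝒮 L ≐ sphereSystem c₀ r₀ W β ×
      B L ≐ (points (c₀ , r₀) ∩ (z ⊕ W ⊥))
  direction-parametrisation {L} (x , x∈BL) (y₁ , U₁ , U₁-sub , (L⊆₁ , ₁⊆L) , U₁-dim) y₀ U U-sub (L⊆ , ⊆L) c₀ r₀ refl =
    W U-sub x∈B , W-isSubspace U-sub x∈B ,
    -- The basis comes with the presentation `y₁ ⊕ U₁` of `L`. Both presentations describe the same
    -- points, so their directions coincide and the basis serves `U`.
    W-hasDim U-sub x∈B (HasDim-resp-≐
      (direction-⊆ U₁-sub U-sub (λ y → L⊆ (₁⊆L y)) , direction-⊆ U-sub U₁-sub (λ y → L⊆₁ (⊆L y))) U₁-dim) ,
    β′ , x , ⟨x,⟩≡-β ,
    ((λ S∈𝒮 → proj₂ 𝒮≐ (L⊆graph S∈𝒮)) , (λ S∈ → graph⊆L (proj₁ 𝒮≐ S∈))) ,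
    ((λ x∈ → proj₁ B≐ (B-antitone graph⊆L x∈)) , (λ x∈ → B-antitone L⊆graph (proj₂ B≐ x∈)))
    where
    x∈B : x ∈ B (y₀ ⊕ U)
    x∈B = B-antitone ⊆L x∈BL

    β′ : LinearFunctional (W U-sub x∈B)
    β′ = β U-sub x∈B

    ⟨x,⟩≡-β : ∀ w (w∈W : w ∈ W U-sub x∈B) → ⟨ x , w ⟩ ≡ - LinearFunctional.to β′ w w∈W
    ⟨x,⟩≡-β w _ = sym (-‿involutive ⟨ x , w ⟩)

    𝒮≐ = 𝒮-graph β′ c₀ r₀
    B≐ = B-graph β′ c₀ r₀ x (W-isSubspace U-sub x∈B) ⟨x,⟩≡-β

    L⊆graph : L ⊆ (y₀ ⊕ graph (W U-sub x∈B) β′)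
    L⊆graph y∈L with L⊆ y∈L
    ... | u , u∈U , eq = u , proj₁ (U≐graph U-sub x∈B) u∈U , eq

    graph⊆L : (y₀ ⊕ graph (W U-sub x∈B) β′) ⊆ L
    graph⊆L (u , u∈graph , eq) = ⊆L (u , proj₂ (U≐graph U-sub x∈B) u∈graph , eq)

  -- Counting `U` inside `𝔽^ (suc d)` would only give `suc d`; its isomorphic projection `W` lives
  -- in `𝔽^ d`.
  affine-dim≤ : 1 ℕ.< q → ∀ {L} → Satisfiable (B L) → ∀ {r} → HasAffineDim L r → r ≤ d
  affine-dim≤ 1<q (x , x∈B) (y₀ , U , U-sub , (L⊆ , ⊆L) , U-dim) =
    dim≤ 1<q (W-hasDim U-sub (B-antitone ⊆L x∈B) U-dim)

  -- Coaxal pencils as affine lines.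

  -- Distinctness of the two spheres matches independence of the direction: injectivity of `Φ` makes
  -- the difference of their lifts nonzero, and a one-vector basis is nonzero, so its translate of
  -- the base point is a second sphere.
  isCoaxalPencil⇔line : ∀ 𝒯 → IsCoaxalPencil 𝒯 ⇔
    (∃[ L ] IsAffineSubspace L × HasAffineDim L 1 × 𝒯 ≐ 𝒮 L)
  isCoaxalPencil⇔line 𝒯 = mk⇔ line pencil
    where
    line : IsCoaxalPencil 𝒯 → ∃[ L ] IsAffineSubspace L × HasAffineDim L 1 × 𝒯 ≐ 𝒮 L
    line (S₀ , S₁ , S₀≢S₁ , 𝒯⊆ , ⊆𝒯) =
      (Φ S₀ ⊕ U) ,
      (Φ S₀ , U , U-sub , (λ y → y) , (λ y → y)) ,
      (Φ S₀ , U , U-sub , ((λ y → y) , (λ y → y)) ,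
        v ∷ [] , singleton-independent v≢0 , (λ u → u) , (λ u → u)) ,
      (λ S∈𝒯 → case 𝒯⊆ S∈𝒯 of λ (t , eq) → _ , (t ∷ [] , refl) , trans eq (join t)) ,
      (λ { (_ , (t ∷ [] , refl) , eq) → ⊆𝒯 (t , trans eq (sym (join t))) })
      where
      v : 𝔽^ (suc d)
      v = Φ S₁ -ᵛ Φ S₀

      U : Pred (𝔽^ (suc d)) 0ℓ
      U = Span (v ∷ [])

      U-sub : IsSubspace U
      U-sub = Span-isSubspace (v ∷ [])

      v≢0 : v ≢ 0ᵛ
      v≢0 v≡0 = S₀≢S₁ (sym (Φ-injective (x-y≡0⇒x≡y (Φ S₁) (Φ S₀) v≡0)))

      join : ∀ t → (1# - t) • Φ S₀ +ᵛ t • Φ S₁ ≡ Φ S₀ +ᵛ combination (t ∷ []) (v ∷ [])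
      join t = trans (cong (λ y → (1# - t) • Φ S₀ +ᵛ t • y) (sym (x+[y-x]≡y (Φ S₀) (Φ S₁))))
                     (join-as-⊕ (Φ S₀) v t)

    pencil : (∃[ L ] IsAffineSubspace L × HasAffineDim L 1 × 𝒯 ≐ 𝒮 L) → IsCoaxalPencil 𝒯
    pencil (L , _ , (y₀ , U , U-sub , (L⊆ , ⊆L) , v ∷ [] , independent , U⊆Span , Span⊆U) , 𝒯⊆ , ⊆𝒯) =
      S₀ , S₁ , S₀≢S₁ ,
      (λ S∈𝒯 → case L⊆ (𝒯⊆ S∈𝒯) of λ (u , u∈U , eq) → case U⊆Span u∈U of λ
        { (t ∷ [] , refl) → t , trans eq (sym (join t)) }) ,
      (λ (t , eq) → ⊆𝒯 (⊆L (_ , Span⊆U (t ∷ [] , refl) , trans eq (join t))))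
      where
      -- Any point of the line and its translate by the basis vector determine the line; `Φ⁻¹` turns
      -- them into spheres.
      S₀ S₁ : Sphere
      S₀ = Φ⁻¹ y₀
      S₁ = Φ⁻¹ (y₀ +ᵛ v)

      S₀≢S₁ : S₀ ≢ S₁
      S₀≢S₁ S₀≡S₁ = independent-singleton-≢0 independent (begin
        v                      ≡⟨ sym (+ᵛ-ᵛ-cancelˡ y₀ v) ⟩
        (y₀ +ᵛ v) -ᵛ y₀        ≡⟨ cong₂ _-ᵛ_ (sym (Φ-Φ⁻¹ (y₀ +ᵛ v))) (sym (Φ-Φ⁻¹ y₀)) ⟩
        Φ S₁ -ᵛ Φ S₀           ≡⟨ cong (λ S → Φ S -ᵛ Φ S₀) (sym S₀≡S₁) ⟩
        Φ S₀ -ᵛ Φ S₀           ≡⟨ x-x≡0 (Φ S₀) ⟩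
        0ᵛ                     ∎)

      join : ∀ t → (1# - t) • Φ S₀ +ᵛ t • Φ S₁ ≡ y₀ +ᵛ combination (t ∷ []) (v ∷ [])
      join t = trans
        (cong₂ (λ y y′ → (1# - t) • y +ᵛ t • y′) (Φ-Φ⁻¹ y₀) (Φ-Φ⁻¹ (y₀ +ᵛ v)))
        (join-as-⊕ y₀ v t)

  -- Incidences and common points of sphere systems.

  incidences-sphereSystem : ∀ c₀ r₀ {W} (β : LinearFunctional W) P 𝒯 →
    (_∈ₗ P) ⊆ B (Φ (c₀ , r₀) ⊕ graph W β) → (_∈ₗ 𝒯) ⊆ sphereSystem c₀ r₀ W β →
    incidences P 𝒯 ≡ length P ℕ.* length 𝒯
  incidences-sphereSystem c₀ r₀ β P 𝒯 P⊆B 𝒯⊆ = Equivalence.from (incidences-complete P 𝒯)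
    (λ {x} {S} x∈P S∈𝒯 → Λ≡0⇒∈points S (P⊆B x∈P (Φ S) (proj₁ (𝒮-graph β c₀ r₀) (𝒯⊆ S∈𝒯))))

  commonPoints-sphereSystem : ∀ c₀ r₀ {W} (β : LinearFunctional W) →
    commonPoints (sphereSystem c₀ r₀ W β) ≐ B (Φ (c₀ , r₀) ⊕ graph W β)
  commonPoints-sphereSystem c₀ r₀ {W} β =
    (λ common → proj₁ (commonPoints-𝒮 L) λ S S∈𝒮 → common S (proj₂ (𝒮-graph β c₀ r₀) S∈𝒮)) ,
    (λ x∈B S S∈ → proj₂ (commonPoints-𝒮 L) x∈B S (proj₁ (𝒮-graph β c₀ r₀) S∈))
    where
    L : Pred (𝔽^ (suc d)) 0ℓ
    L = Φ (c₀ , r₀) ⊕ graph W β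

1<prime-power : ∀ {q} → IsPrimePower q → 1 ℕ.< q
1<prime-power (p , k , p-prime , 1≤k , refl) =
  -- The left side `1` is `p ^ 0`, so the exponents compared are `0` and `k`.
  ℕ.^-monoʳ-< p (ℕ.nonTrivial⇒n>1 p {{prime⇒nonTrivial p-prime}}) 1≤k

open import Data.Nat.Base using (_*_)

proposition2p7 :
  (q : ℕ) → IsPrimePower q → ¬ (2 ∣ q) → (F : FiniteField q) →
  (d : ℕ) → 2 ≤ d →
  let open FiniteField F hiding (_*_) in
  let open LinearAlgebra F in
  (Q : QuadraticForm d) →
  let open SphereGeometry F Q in
  NonDegenerate →
  -- (a)
  ( (P : List (𝔽^ d)) → Unique P → P ≢ [] →
    (𝒯 : List Sphere) → Unique 𝒯 → 𝒯 ≢ [] →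
    let L = aff (_∈ₗ map Φ 𝒯) in
    (incidences P 𝒯 ≡ length P * length 𝒯) ⇔
    ((_∈ₗ P) ⊆ B L × (_∈ₗ 𝒯) ⊆ 𝒮 L) )
  ×
  -- (b)
  ( (L : Pred (𝔽^ (suc d)) 0ℓ) → IsAffineSubspace L → Satisfiable (B L) →
    (r : ℕ) → HasAffineDim L r →
    r ≤ d ×
    ( (y₀ : 𝔽^ (suc d)) (U : Pred (𝔽^ (suc d)) 0ℓ) →
      IsSubspace U → L ≐ y₀ ⊕ U →
      (∃[ S₀ ] y₀ ≡ Φ S₀) ×
      ( (c₀ : 𝔽^ d) (r₀ : Carrier) → y₀ ≡ Φ (c₀ , r₀) →
        Σ (Pred (𝔽^ d) 0ℓ) λ W → IsSubspace W × HasDim W r ×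
        Σ (LinearFunctional W) λ β →
        Σ (𝔽^ d) λ z →
          (∀ w (w∈W : w ∈ W) → ⟨ z , w ⟩ ≡ - LinearFunctional.to β w w∈W) ×
          𝒮 L ≐ sphereSystem c₀ r₀ W β ×
          B L ≐ (points (c₀ , r₀) ∩ (z ⊕ W ⊥)) ) ) )
  ×
  -- (c)
  ( (c₀ : 𝔽^ d) (r₀ : Carrier) (W : Pred (𝔽^ d) 0ℓ) → IsSubspace W →
    (β : LinearFunctional W) (z : 𝔽^ d) →
    (∀ w (w∈W : w ∈ W) → ⟨ z , w ⟩ ≡ - LinearFunctional.to β w w∈W) →
    let L = Φ (c₀ , r₀) ⊕ graph W β in
    IsAffineSubspace L ×
    sphereSystem c₀ r₀ W β ≐ 𝒮 L ×
    commonPoints (sphereSystem c₀ r₀ W β) ≐ B L ×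
    B L ≐ (points (c₀ , r₀) ∩ (z ⊕ W ⊥)) ×
    ( Satisfiable (B L) →
      (P : List (𝔽^ d)) → Unique P → P ≢ [] → (_∈ₗ P) ⊆ B L →
      (𝒯 : List Sphere) → Unique 𝒯 → 𝒯 ≢ [] →
      (_∈ₗ 𝒯) ⊆ sphereSystem c₀ r₀ W β →
      incidences P 𝒯 ≡ length P * length 𝒯 ) )
  ×
  -- (d)
  ( (𝒯 : Pred Sphere 0ℓ) →
    IsCoaxalPencil 𝒯 ⇔
    (∃[ L ] IsAffineSubspace L × HasAffineDim L 1 × 𝒯 ≐ 𝒮 L) )
proposition2p7 q q-primePower q-odd F d _ Q _ =
  (λ P _ _ 𝒯 _ _ → incidences-aff P 𝒯) ,
  (λ L _ B-nonempty r L-dim →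
    affine-dim≤ (1<prime-power q-primePower) B-nonempty L-dim ,
    λ y₀ U U-sub L≐ → (Φ⁻¹ y₀ , sym (Φ-Φ⁻¹ y₀)) , direction-parametrisation B-nonempty L-dim y₀ U U-sub L≐) ,
  (λ c₀ r₀ W W-sub β z ⟨z,⟩≡-β →
    (Φ (c₀ , r₀) , graph W β , graph-isSubspace β W-sub , (λ y → y) , (λ y → y)) ,
    𝒮-graph β c₀ r₀ ,
    commonPoints-sphereSystem c₀ r₀ β ,
    B-graph β c₀ r₀ z W-sub ⟨z,⟩≡-β ,
    λ _ P _ _ P⊆B 𝒯 _ _ 𝒯⊆ → incidences-sphereSystem c₀ r₀ β P 𝒯 P⊆B 𝒯⊆) ,
  isCoaxalPencil⇔line
  where
  open LinearAlgebra F using (graph)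
  open SphereGeometry F Q using (Φ)
  open SphereProperties F (FieldProperties.2≢0 F q-odd) Q
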